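{- Let $m$ be the number of registers of a HyperLogLog sketch into which $n$ distinct elements have been inserted, let $\beta\in(0,1)$, and suppose $n>2m^2/\beta$. Let $B=\log_2\frac{n}{m}$ and $\Delta=\log_2\frac{2m}{\beta}$. Then with probability at least $1-\beta$, all register values $M[j]$, $j\in[m]$, lie in the interval $(B-\Delta,B+\Delta)$, so that all register values can be represented as offsets from the base value $B$ using at most $\lceil \log_2\log_2\frac{2m}{\beta}\rceil+1=O(\log\log m)$ bits each.
   Context: HyperLogLog model: each of $n$ distinct elements $y_i$ is assigned a register index $f(y_i)$ uniform in $[m]=\{1,\dots,m\}$ and a value $\rho_i$ with $\Pr[\rho_i=k]=2^{ -k}$, $k=1,2,\dots$ (the position of the first one-bit of a uniformly random hash value), all independent; register $M[j]$ is the maximum of $\rho_i$ over elements with $f(y_i)=j$ (0 if none), so $\Pr[M[j]\le k]=(1-\frac{1}{m2^k})^n$ for integers $k\ge 0$. Convention: register values are treated as real-valued continuous random variables whose individual distribution function is $\Pr[M[j]\le t]=\Pr[M[j]<t]=(1-\frac{1}{m2^t})^n$ for real $t$. -}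

module Defs where

open import Algebra.Bundles using (CommutativeRing; Semiring)
import Algebra.Definitions.RawSemiring as RawSemiringDefs
open import Axiom.ExcludedMiddle using (ExcludedMiddle)
open import Data.Bool.Base using (Bool)
open import Data.Fin.Base using (Fin; toℕ)
open import Data.Integer.Base as ℤ using (ℤ; +_; -[1+_])
open import Data.Nat.Base as ℕ using (ℕ; suc)
open import Data.Product.Base using (∃; _×_; proj₁)
open import Data.Rational.Base using (ℚ; ↥_; ↧_; ↧ₙ_)
open import Data.Sum.Base using ([_,_]′)
open import Data.Vec.Base using (Vec)
open import Function.Base using (const)
open import Level using (0ℓ)
  renaming (suc to lsuc)
open import Relation.Binary.Core using (Rel)
import Relation.Binary.Construct.NonStrictToStrict as ToStrict
open import Relation.Binary.PropositionalEquality.Core using (_≢_)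
open import Relation.Binary.Structures using (IsTotalOrder)
open import Relation.Nullary using (¬_; yes; no)
open import Relation.Unary using (Pred; U; ∁; ⋃; Satisfiable; _≐_; _⊥_)

-- The real numbers, as a Dedekind-complete ordered field (unique up to
-- isomorphism).  Equality is a setoid equality.
record RealField : Set (lsuc 0ℓ) where
  infix 4 _≤_ _<_
  field
    commutativeRing : CommutativeRing 0ℓ 0ℓ

  open CommutativeRing commutativeRing public
    renaming (Carrier to ℝ)

  field
    _≤_          : Rel ℝ 0ℓ
    isTotalOrder : IsTotalOrder _≈_ _≤_
    1≉0          : ¬ (1# ≈ 0#)
    inverse      : ∀ x → ¬ (x ≈ 0#) → ∃ λ y → x * y ≈ 1#
    +-monoʳ-≤    : ∀ z {x y} → x ≤ y → z + x ≤ z + y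
    *-nonNeg     : ∀ {x y} → 0# ≤ x → 0# ≤ y → 0# ≤ x * y

  open IsTotalOrder isTotalOrder public using (total)

  _<_ : Rel ℝ 0ℓ
  _<_ = ToStrict._<_ _≈_ _≤_

  IsUpperBound : Pred ℝ 0ℓ → Pred ℝ 0ℓ
  IsUpperBound S u = ∀ x → S x → x ≤ u

  IsSupremum : Pred ℝ 0ℓ → Pred ℝ 0ℓ
  IsSupremum S s = IsUpperBound S s × (∀ u → IsUpperBound S u → s ≤ u)

  field
    complete : ∀ (S : Pred ℝ 0ℓ) → Satisfiable S →
               Satisfiable (IsUpperBound S) → Satisfiable (IsSupremum S)

-- Excluded middle is used to turn "the x such that P x" into a function.
module Real (em : ExcludedMiddle 0ℓ) (R : RealField) where

  open RealField R public
  open RawSemiringDefs (Semiring.rawSemiring semiring) public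
    using (_^_; sum)
    renaming (_×_ to _·_)

  -- Some x satisfying P if there is one, and the given default otherwise.  It
  -- is only applied to predicates that determine x (up to ≈).
  the : {A : Set} → A → Pred A 0ℓ → A
  the default P with em {∃ P}
  ... | yes p = proj₁ p
  ... | no  _ = default

  infixl 7 _/_
  _/_ : ℝ → ℝ → ℝ
  x / y = the 0# (λ z → z * y ≈ x)

  fromℕ : ℕ → ℝ
  fromℕ n = n · 1#

  fromℤ : ℤ → ℝ
  fromℤ (+ n)    = fromℕ n
  fromℤ -[1+ n ] = - fromℕ (suc n)

  fromℚ : ℚ → ℝ
  fromℚ r = fromℤ (↥ r) / fromℤ (↧ r)

  ∣_∣ : ℝ → ℝ
  ∣ x ∣ = [ const x , const (- x) ]′ (total 0# x)

  ⌈_⌉ : ℝ → ℤ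
  ⌈ x ⌉ = the (+ 0) (λ k → x ≤ fromℤ k × (∀ j → x ≤ fromℤ j → k ℤ.≤ j))

  2^ℤ_ : ℤ → ℝ
  2^ℤ (+ n)    = fromℕ 2 ^ n
  2^ℤ -[1+ n ] = 1# / (fromℕ 2 ^ suc n)

  -- y = 2^r, that is, y is the positive b-th root of 2^a where r = a/b.
  IsRationalPower : ℚ → Pred ℝ 0ℓ
  IsRationalPower r y = 0# < y × y ^ ↧ₙ r ≈ 2^ℤ (↥ r)

  -- 2^t is the supremum of all 2^r with r rational and r ≤ t.
  infix 9 2^_
  2^_ : ℝ → ℝ
  2^ t = the 0# (IsSupremum λ y → ∃ λ r → fromℚ r ≤ t × IsRationalPower r y)

  -- Meaningful for positive arguments only.
  log₂ : ℝ → ℝ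
  log₂ x = the 0# (λ t → 2^ t ≈ x)

  infix 4 _⟶_ _=O_
  _⟶_ : (ℕ → ℝ) → ℝ → Set
  s ⟶ l = ∀ ε → 0# < ε → ∃ λ N → ∀ n → N ℕ.≤ n → ∣ s n - l ∣ < ε

  _=O_ : (ℕ → ℝ) → (ℕ → ℝ) → Set
  f =O g = ∃ λ C → ∃ λ N → ∀ n → N ℕ.≤ n → ∣ f n ∣ ≤ C * ∣ g n ∣

  -- ℙ is defined on all subsets, but only its values on events are
  -- constrained.
  record ProbabilitySpace : Set (lsuc 0ℓ) where
    field
      Ω       : Set
      Event   : Pred Ω 0ℓ → Set
      Event-≐ : ∀ {A B} → A ≐ B → Event A → Event B
      Event-U : Event U
      Event-∁ : ∀ {A} → Event A → Event (∁ A)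
      Event-⋃ : ∀ (A : ℕ → Pred Ω 0ℓ) → (∀ i → Event (A i)) → Event (⋃ ℕ A)
      ℙ       : Pred Ω 0ℓ → ℝ
      ℙ-≐     : ∀ {A B} → Event A → A ≐ B → ℙ A ≈ ℙ B
      ℙ-nonNeg : ∀ {A} → Event A → 0# ≤ ℙ A
      ℙ-U     : ℙ U ≈ 1#
      ℙ-⋃     : ∀ (A : ℕ → Pred Ω 0ℓ) → (∀ i → Event (A i)) →
                (∀ i j → i ≢ j → A i ⊥ A j) →
                (λ N → sum {N} (λ i → ℙ (A (toℕ i)))) ⟶ ℙ (⋃ ℕ A)

  -- The m registers after inserting n distinct elements, as real random
  -- variables with the continuous distribution function (1 - 1/(m 2^t))^n.
  -- Only t > 0 is required: for t < - log₂ m the formula is not a probability,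
  -- and excluding t = 0 admits registers that are 0 with positive probability
  -- and never negative.  Nothing is assumed on the joint distribution.
  record HyperLogLog (m n : ℕ) : Set (lsuc 0ℓ) where
    field
      space : ProbabilitySpace

    open ProbabilitySpace space public

    cdf : ℝ → ℝ
    cdf t = (1# - 1# / (fromℕ m * 2^ t)) ^ n

    field
      M            : Fin m → Ω → ℝ
      M-measurable : ∀ j t → Event (λ ω → M j ω ≤ t)
      ℙ[M≤t]       : ∀ j t → 0# < t → ℙ (λ ω → M j ω ≤ t) ≈ cdf t
      ℙ[M<t]       : ∀ j t → 0# < t → ℙ (λ ω → M j ω < t) ≈ cdf t

  OpenInterval : ℝ → ℝ → Pred ℝ 0ℓ
  OpenInterval a b x = a < x × x < b

  IsInteger : Pred ℝ 0ℓ
  IsInteger x = ∃ λ k → x ≈ fromℤ k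

  -- Words of d bits denote offsets from the base so that every value in I is
  -- represented: exactly if it is an integer, as register contents are, and up
  -- to an error below 1 otherwise (no finite code is exact on an interval).
  RepresentableAsOffsets : ℝ → Pred ℝ 0ℓ → ℕ → Set
  RepresentableAsOffsets base I d =
    ∃ λ (offset : Vec Bool d → ℝ) → ∀ x → I x → ∃ λ c →
      (IsInteger x → base + offset c ≈ x) × ∣ (base + offset c) - x ∣ < 1#

-- By P(M ≤ t) = (1 - 1/(m 2^t))^n, Bernoulli's inequality bounds each of the
-- events M[j] ≤ B - Δ and M[j] ≥ B + Δ by β/(2m); a union bound over the 2m
-- events gives the probability.  Here n > 2m²/β makes B - Δ positive.
--
-- The logarithm of x ≥ 1 is obtained as the cut {a/b : 2^a ≤ x^b}, which needs
-- neither roots nor real powers: it is additive because n (log xy - log x - log y)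
-- stays bounded, positive for x > 1, hence strictly increasing, and onto [0,∞) by
-- completeness.
-- For t ≥ 0 its inverse is the supremum defining 2^t.
--
-- The 2^d codes, d = ⌈log₂ Δ⌉ + 1, stand for consecutive integers from the
-- first one above B - Δ on; 2Δ ≤ 2^d makes them cover the interval.
module Submission where

open import Defs
import Algebra.Properties.CommutativeSemiring.Exp as Exp
import Algebra.Properties.Ring as RingProperties
import Algebra.Properties.Semiring.Mult as SemiringMult
import Algebra.Properties.Semiring.Mult.TCOptimised as SemiringMult′
import Algebra.Solver.Ring as RingSolver
open import Algebra.Solver.Ring.AlmostCommutativeRing
  using (fromCommutativeRing; _-Raw-AlmostCommutative⟶_)
open import Axiom.DoubleNegationElimination using (em⇒dne)
open import Axiom.ExcludedMiddle using (ExcludedMiddle)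
open import Data.Bool.Base using (Bool; true; false)
open import Data.Empty using (⊥-elim)
open import Data.Fin.Base as Fin using (Fin)
open import Data.Integer.Base as ℤ using (ℤ; +_; -[1+_])
import Data.Integer.Properties as ℤ
open import Data.Maybe.Base using (Maybe; nothing; just)
open import Data.Nat.Base as ℕ using (ℕ; suc; z≤n; s≤s; NonZero)
open import Data.Nat.GCD using (gcd)
import Data.Nat.Properties as ℕ
open import Data.Product.Base using (∃; _×_; _,_; proj₁; proj₂)
open import Data.Rational.Base as ℚ using (ℚ; mkℚ; ↥_; ↧_)
import Data.Rational.Properties as ℚ
open import Data.Sum.Base using (_⊎_; inj₁; inj₂; [_,_]′)
open import Data.Vec.Base using (Vec; []; _∷_)
open import Function.Base using (_∘_)
open import Level using (0ℓ)
open import Relation.Binary.Bundles using (Poset)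
open import Relation.Binary.PropositionalEquality.Core as ≡ using (_≡_; _≢_)
import Relation.Binary.Reasoning.PartialOrder as PartialOrderReasoning
import Relation.Binary.Reasoning.Setoid as SetoidReasoning
open import Relation.Binary.Structures using (IsTotalOrder)
open import Relation.Nullary using (¬_; yes; no)
open import Relation.Unary using (Pred; U; ∁; ⋃; ∅; _∪_; _∩_; _≐_; _⊥_)

-- Put L = 2m/β, so that Δ = log₂ L. At t = B - Δ and t = B + Δ the quantity n/(m 2^t) equals L and
-- 1/L; this is what the choice of Δ achieves. The lower tail is in truth exponentially small in L,
-- but the cruder 1/L = β/(2m) already matches the upper tail and leaves exactly β for the 2m
-- events. The obstacle is that `2^_` and `log₂` are mere descriptions: `the` returns some witness,
-- or a default when there is none, and a supremum of rational powers does not visibly obey any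
-- exponential law. Hence the laws are proved for a relation between a number and its logarithm, and
-- only then carried over to `2^_` and `log₂`. The relation covers only numbers ≥ 1, which is
-- enough: L > 2, Δ > 1 and n/m > L, so both B - Δ and B + Δ are positive. Positivity of B - Δ
-- matters for the registers too, since their distribution function is given only at t > 0.

-- Integer coefficients for the ring solver

module IntegerCoefficients (R : RealField) where
  open RealField R
  open RingProperties ring using (-0#≈0#; -‿distribˡ-*; -‿distribʳ-*; -‿involutive; -‿+-comm)
  open SemiringMult′ semiring using (×1-homo-*; ×-homo-+; 1+×)
    renaming (_×_ to _×′_)
  open SetoidReasoning setoid

  -- The optimised multiple makes `⟦ + 1 ⟧` reduce to `1#` rather than to `1# + 0#`, so that solver
  -- literals match the `0#` and `1#` of a goal by computation.
  ⟦_⟧ : ℤ → ℝ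
  ⟦ + n ⟧      = n ×′ 1#
  ⟦ -[1+ n ] ⟧ = - (suc n ×′ 1#)

  ⟦⟧-neg : ∀ i → ⟦ ℤ.- i ⟧ ≈ - ⟦ i ⟧
  ⟦⟧-neg (+ 0)      = sym -0#≈0#
  ⟦⟧-neg (+ suc n)  = refl
  ⟦⟧-neg -[1+ n ]   = sym (-‿involutive _)

  ⟦⟧-⊖ : ∀ m n → ⟦ m ℤ.⊖ n ⟧ ≈ ⟦ + m ⟧ - ⟦ + n ⟧
  ⟦⟧-⊖ m 0 = sym (trans (+-congˡ -0#≈0#) (+-identityʳ _))
  ⟦⟧-⊖ 0 (suc n) = sym (+-identityˡ _)
  ⟦⟧-⊖ (suc m) (suc n) = begin
    ⟦ suc m ℤ.⊖ suc n ⟧                ≡⟨ ≡.cong ⟦_⟧ (ℤ.[1+m]⊖[1+n]≡m⊖n m n) ⟩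
    ⟦ m ℤ.⊖ n ⟧                        ≈⟨ ⟦⟧-⊖ m n ⟩
    ⟦ + m ⟧ - ⟦ + n ⟧                  ≈⟨ +-congʳ (+-identityʳ _) ⟨
    ⟦ + m ⟧ + 0# - ⟦ + n ⟧             ≈⟨ +-congʳ (+-congˡ (-‿inverseʳ 1#)) ⟨
    ⟦ + m ⟧ + (1# - 1#) - ⟦ + n ⟧      ≈⟨ +-congʳ (+-assoc _ _ _) ⟨
    ⟦ + m ⟧ + 1# - 1# - ⟦ + n ⟧        ≈⟨ +-assoc _ _ _ ⟩
    ⟦ + m ⟧ + 1# + (- 1# - ⟦ + n ⟧)    ≈⟨ +-cong (+-comm _ _) (-‿+-comm _ _) ⟩
    1# + ⟦ + m ⟧ - (1# + ⟦ + n ⟧)      ≈⟨ +-cong (1+× m 1#) (-‿cong (1+× n 1#)) ⟨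
    ⟦ + suc m ⟧ - ⟦ + suc n ⟧          ∎

  ⟦⟧-+ : ∀ i j → ⟦ i ℤ.+ j ⟧ ≈ ⟦ i ⟧ + ⟦ j ⟧
  ⟦⟧-+ (+ m)    (+ n)    = ×-homo-+ 1# m n
  ⟦⟧-+ (+ m)    -[1+ n ] = ⟦⟧-⊖ m (suc n)
  ⟦⟧-+ -[1+ m ] (+ n)    = trans (⟦⟧-⊖ n (suc m)) (+-comm _ _)
  ⟦⟧-+ -[1+ m ] -[1+ n ] = begin
    - (suc (suc (m ℕ.+ n)) ×′ 1#)       ≡⟨ ≡.cong (λ k → - (suc k ×′ 1#)) (ℕ.+-suc m n) ⟨
    - ((suc m ℕ.+ suc n) ×′ 1#)         ≈⟨ -‿cong (×-homo-+ 1# (suc m) (suc n)) ⟩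
    - (suc m ×′ 1# + suc n ×′ 1#)       ≈⟨ -‿+-comm _ _ ⟨
    - (suc m ×′ 1#) - (suc n ×′ 1#)     ∎

  ⟦⟧-*⁺ : ∀ m n → ⟦ + m ℤ.* + n ⟧ ≈ ⟦ + m ⟧ * ⟦ + n ⟧
  ⟦⟧-*⁺ m n = trans (reflexive (≡.cong ⟦_⟧ (≡.sym (ℤ.pos-* m n)))) (×1-homo-* m n)

  ⟦⟧-*ʳ : ∀ m j → ⟦ + m ℤ.* j ⟧ ≈ ⟦ + m ⟧ * ⟦ j ⟧
  ⟦⟧-*ʳ m (+ n)    = ⟦⟧-*⁺ m n
  ⟦⟧-*ʳ m -[1+ n ] = begin
    ⟦ + m ℤ.* (ℤ.- + suc n) ⟧   ≡⟨ ≡.cong ⟦_⟧ (ℤ.neg-distribʳ-* (+ m) (+ suc n)) ⟨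
    ⟦ ℤ.- (+ m ℤ.* + suc n) ⟧   ≈⟨ ⟦⟧-neg (+ m ℤ.* + suc n) ⟩
    - ⟦ + m ℤ.* + suc n ⟧       ≈⟨ -‿cong (⟦⟧-*⁺ m (suc n)) ⟩
    - (⟦ + m ⟧ * ⟦ + suc n ⟧)   ≈⟨ -‿distribʳ-* _ _ ⟩
    ⟦ + m ⟧ * - ⟦ + suc n ⟧     ∎

  ⟦⟧-* : ∀ i j → ⟦ i ℤ.* j ⟧ ≈ ⟦ i ⟧ * ⟦ j ⟧
  ⟦⟧-* (+ m)    j = ⟦⟧-*ʳ m j
  ⟦⟧-* -[1+ m ] j = begin
    ⟦ (ℤ.- + suc m) ℤ.* j ⟧     ≡⟨ ≡.cong ⟦_⟧ (ℤ.neg-distribˡ-* (+ suc m) j) ⟨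
    ⟦ ℤ.- (+ suc m ℤ.* j) ⟧     ≈⟨ ⟦⟧-neg (+ suc m ℤ.* j) ⟩
    - ⟦ + suc m ℤ.* j ⟧         ≈⟨ -‿cong (⟦⟧-*ʳ (suc m) j) ⟩
    - (⟦ + suc m ⟧ * ⟦ j ⟧)     ≈⟨ -‿distribˡ-* _ _ ⟩
    - ⟦ + suc m ⟧ * ⟦ j ⟧       ∎

  ⟦⟧-homomorphism :
    ℤ.+-*-rawRing -Raw-AlmostCommutative⟶ fromCommutativeRing commutativeRing
  ⟦⟧-homomorphism = record
    { ⟦_⟧    = ⟦_⟧
    ; +-homo = ⟦⟧-+
    ; *-homo = ⟦⟧-*
    ; -‿homo = ⟦⟧-neg
    ; 0-homo = refl
    ; 1-homo = refl
    }

  ⟦⟧-≟ : ∀ i j → Maybe (⟦ i ⟧ ≈ ⟦ j ⟧)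
  ⟦⟧-≟ i j with i ℤ.≟ j
  ... | yes i≡j = just (reflexive (≡.cong ⟦_⟧ i≡j))
  ... | no _    = nothing

  open RingSolver ℤ.+-*-rawRing (fromCommutativeRing commutativeRing) ⟦⟧-homomorphism ⟦⟧-≟ public
    using (solve; _:+_; _:*_; _:-_; :-_; _:=_; con)

-- Ordered field arithmetic, Bernoulli's inequality, the Archimedean property

module OrderedField (em : ExcludedMiddle 0ℓ) (R : RealField) where
  open Real em R
  open IntegerCoefficients R
  open SemiringMult semiring using (×-homo-+; ×1-homo-*)
  module ≤ = IsTotalOrder isTotalOrder

  poset : Poset 0ℓ 0ℓ 0ℓ
  poset = record { isPartialOrder = ≤.isPartialOrder }

  module ≤-Reasoning = PartialOrderReasoning poset
  open ≤-Reasoning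

  ≤-resp : ∀ {x x′ y y′} → x ≈ x′ → y ≈ y′ → x ≤ y → x′ ≤ y′
  ≤-resp x≈x′ y≈y′ x≤y = ≤.trans (≤.reflexive (sym x≈x′)) (≤.trans x≤y (≤.reflexive y≈y′))

  <-resp : ∀ {x x′ y y′} → x ≈ x′ → y ≈ y′ → x < y → x′ < y′
  <-resp x≈x′ y≈y′ (x≤y , x≉y) =
    ≤-resp x≈x′ y≈y′ x≤y , λ x′≈y′ → x≉y (trans x≈x′ (trans x′≈y′ (sym y≈y′)))

  <⇒≱ : ∀ {x y} → x < y → ¬ (y ≤ x)
  <⇒≱ (x≤y , x≉y) y≤x = x≉y (≤.antisym x≤y y≤x)

  ≰⇒> : ∀ {x y} → ¬ (x ≤ y) → y < x
  ≰⇒> {x} {y} x≰y with total x y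
  ... | inj₁ x≤y = ⊥-elim (x≰y x≤y)
  ... | inj₂ y≤x = y≤x , λ y≈x → x≰y (≤.reflexive (sym y≈x))

  infix 4 _≤?_
  abstract
    _≤?_ : ∀ x y → x ≤ y ⊎ y < x
    x ≤? y with em {x ≤ y}
    ... | yes x≤y = inj₁ x≤y
    ... | no x≰y  = inj₂ (≰⇒> x≰y)

  ≮⇒≥ : ∀ {x y} → ¬ (x < y) → y ≤ x
  ≮⇒≥ {x} {y} x≮y with y ≤? x
  ... | inj₁ y≤x = y≤x
  ... | inj₂ x<y = ⊥-elim (x≮y x<y)

  <-≤-trans : ∀ {x y z} → x < y → y ≤ z → x < z
  <-≤-trans {x} {y} {z} x<y y≤z = begin-strict x <⟨ x<y ⟩ y ≤⟨ y≤z ⟩ z ∎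

  ≤-<-trans : ∀ {x y z} → x ≤ y → y < z → x < z
  ≤-<-trans {x} {y} {z} x≤y y<z = begin-strict x ≤⟨ x≤y ⟩ y <⟨ y<z ⟩ z ∎

  <-trans : ∀ {x y z} → x < y → y < z → x < z
  <-trans x<y y<z = <-≤-trans x<y (proj₁ y<z)

  ≤⇒0≤ : ∀ {x y} → x ≤ y → 0# ≤ y - x
  ≤⇒0≤ {x} {y} x≤y = ≤-resp (-‿inverseˡ x) (+-comm _ _) (+-monoʳ-≤ (- x) x≤y)

  -- The ring solver proves only equations. An inequality is therefore reduced to a term `d` that is
  -- visibly non-negative and a polynomial identity for `d`.
  ≤-by : ∀ {x y d} → 0# ≤ d → d ≈ y - x → x ≤ y
  ≤-by {x} {y} 0≤d d≈y-x =
    ≤-resp (+-identityʳ x)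
      (trans (+-congˡ d≈y-x) (solve 2 (λ x y → x :+ (y :- x) := y) refl x y))
      (+-monoʳ-≤ x 0≤d)

  <⇒0< : ∀ {x y} → x < y → 0# < y - x
  <⇒0< {x} {y} x<y = ≰⇒> λ y-x≤0 →
    <⇒≱ x<y (≤-by (≤⇒0≤ y-x≤0) (solve 2 (λ x y → con (+ 0) :- (y :- x) := x :- y) refl x y))

  <-by : ∀ {x y d} → 0# < d → d ≈ y - x → x < y
  <-by {x} {y} {d} 0<d d≈y-x = ≰⇒> λ y≤x →
    <⇒≱ 0<d (≤-by (≤⇒0≤ y≤x)
      (trans (solve 2 (λ x y → x :- y := con (+ 0) :- (y :- x)) refl x y)
             (+-congˡ (-‿cong (sym d≈y-x)))))

  +-nonNeg : ∀ {x y} → 0# ≤ x → 0# ≤ y → 0# ≤ x + y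
  +-nonNeg {x} {y} 0≤x 0≤y = begin
    0#      ≤⟨ 0≤x ⟩
    x       ≈⟨ +-identityʳ x ⟨
    x + 0#  ≤⟨ +-monoʳ-≤ x 0≤y ⟩
    x + y   ∎

  +-pos : ∀ {x y} → 0# < x → 0# ≤ y → 0# < x + y
  +-pos {x} {y} 0<x 0≤y = begin-strict
    0#      <⟨ 0<x ⟩
    x       ≈⟨ +-identityʳ x ⟨
    x + 0#  ≤⟨ +-monoʳ-≤ x 0≤y ⟩
    x + y   ∎

  +-mono-≤ : ∀ {x y u v} → x ≤ y → u ≤ v → x + u ≤ y + v
  +-mono-≤ {x} {y} {u} {v} x≤y u≤v = ≤-by (+-nonNeg (≤⇒0≤ x≤y) (≤⇒0≤ u≤v))
    (solve 4 (λ x y u v → (y :- x) :+ (v :- u) := (y :+ v) :- (x :+ u)) refl x y u v)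

  +-mono-<-≤ : ∀ {x y u v} → x < y → u ≤ v → x + u < y + v
  +-mono-<-≤ {x} {y} {u} {v} x<y u≤v = <-by (+-pos (<⇒0< x<y) (≤⇒0≤ u≤v))
    (solve 4 (λ x y u v → (y :- x) :+ (v :- u) := (y :+ v) :- (x :+ u)) refl x y u v)

  neg-anti-≤ : ∀ {x y} → x ≤ y → - y ≤ - x
  neg-anti-≤ {x} {y} x≤y = ≤-by (≤⇒0≤ x≤y) (solve 2 (λ x y → y :- x := :- x :- :- y) refl x y)

  *-monoˡ-≤ : ∀ {x y z} → 0# ≤ z → x ≤ y → z * x ≤ z * y
  *-monoˡ-≤ {x} {y} {z} 0≤z x≤y = ≤-by (*-nonNeg 0≤z (≤⇒0≤ x≤y))
    (solve 3 (λ x y z → z :* (y :- x) := z :* y :- z :* x) refl x y z)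

  *-mono-≤ : ∀ {x y u v} → 0# ≤ x → x ≤ y → 0# ≤ u → u ≤ v → x * u ≤ y * v
  *-mono-≤ {x} {y} {u} {v} 0≤x x≤y 0≤u u≤v = begin
    x * u  ≤⟨ *-monoˡ-≤ 0≤x u≤v ⟩
    x * v  ≈⟨ *-comm x v ⟩
    v * x  ≤⟨ *-monoˡ-≤ (≤.trans 0≤u u≤v) x≤y ⟩
    v * y  ≈⟨ *-comm v y ⟩
    y * v  ∎

  x*y≈0⇒y≈0 : ∀ {x y} → ¬ (x ≈ 0#) → x * y ≈ 0# → y ≈ 0#
  x*y≈0⇒y≈0 {x} {y} x≉0 x*y≈0 with inverse x x≉0
  ... | x⁻¹ , x*x⁻¹≈1 = begin-equality
    y              ≈⟨ *-identityˡ y ⟨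
    1# * y         ≈⟨ *-congʳ x*x⁻¹≈1 ⟨
    x * x⁻¹ * y    ≈⟨ solve 3 (λ x y z → x :* z :* y := z :* (x :* y)) refl x y x⁻¹ ⟩
    x⁻¹ * (x * y)  ≈⟨ *-congˡ x*y≈0 ⟩
    x⁻¹ * 0#       ≈⟨ zeroʳ x⁻¹ ⟩
    0#             ∎

  *-pos : ∀ {x y} → 0# < x → 0# < y → 0# < x * y
  *-pos (0≤x , 0≉x) (0≤y , 0≉y) = *-nonNeg 0≤x 0≤y ,
    λ 0≈xy → 0≉y (sym (x*y≈0⇒y≈0 (0≉x ∘ sym) (sym 0≈xy)))

  *-monoˡ-< : ∀ {x y z} → 0# < z → x < y → z * x < z * y
  *-monoˡ-< {x} {y} {z} 0<z x<y = <-by (*-pos 0<z (<⇒0< x<y))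
    (solve 3 (λ x y z → z :* (y :- x) := z :* y :- z :* x) refl x y z)

  *-cancelˡ-≤ : ∀ {x y z} → 0# < z → z * x ≤ z * y → x ≤ y
  *-cancelˡ-≤ 0<z zx≤zy = ≮⇒≥ λ y<x → <⇒≱ (*-monoˡ-< 0<z y<x) zx≤zy

  *-cancelˡ-< : ∀ {x y z} → 0# < z → z * x < z * y → x < y
  *-cancelˡ-< 0<z zx<zy = ≰⇒> λ y≤x → <⇒≱ zx<zy (*-monoˡ-≤ (proj₁ 0<z) y≤x)

  *-cancelˡ-≈ : ∀ {x y z} → 0# < z → z * x ≈ z * y → x ≈ y
  *-cancelˡ-≈ 0<z zx≈zy = ≤.antisym
    (*-cancelˡ-≤ 0<z (≤.reflexive zx≈zy)) (*-cancelˡ-≤ 0<z (≤.reflexive (sym zx≈zy)))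

  0≤1 : 0# ≤ 1#
  0≤1 with total 0# 1#
  ... | inj₁ 0≤1 = 0≤1
  -- Here `0# - 1#` would be non-negative, and its square is `1#`.
  ... | inj₂ 1≤0 = ≤-by (*-nonNeg (≤⇒0≤ 1≤0) (≤⇒0≤ 1≤0))
    (solve 0 ((con (+ 0) :- con (+ 1)) :* (con (+ 0) :- con (+ 1)) := con (+ 1) :- con (+ 0)) refl)

  0<1 : 0# < 1#
  0<1 = 0≤1 , λ 0≈1 → 1≉0 (sym 0≈1)

  x<x+1 : ∀ x → x < x + 1#
  x<x+1 x = <-by 0<1 (solve 1 (λ x → con (+ 1) := (x :+ con (+ 1)) :- x) refl x)

  abstract
    positive-inverse : ∀ {x} → 0# < x → ∃ λ y → 0# < y × x * y ≈ 1#
    positive-inverse {x} 0<x with inverse x (proj₂ 0<x ∘ sym)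
    ... | y , xy≈1 = y , *-cancelˡ-< 0<x (<-resp (sym (zeroʳ x)) (sym xy≈1) 0<1) , xy≈1

  -- For descriptions without a constructed witness, as `2^ t` with `t ≤ 0#`: the default is then a
  -- case to be handled.
  the-cases : ∀ {A : Set} (default : A) (P : Pred A 0ℓ) → P (the default P) ⊎ the default P ≡ default
  the-cases default P with em {∃ P}
  ... | yes (_ , p) = inj₁ p
  ... | no _        = inj₂ ≡.refl

  the-satisfies : ∀ {A : Set} (default : A) (P : Pred A 0ℓ) → ∃ P → P (the default P)
  the-satisfies default P ∃P with em {∃ P}
  ... | yes (_ , p) = p
  ... | no ∄P       = ⊥-elim (∄P ∃P)

  /-cancel : ∀ {x y} → 0# < y → x / y * y ≈ x
  /-cancel {x} {y} 0<y with inverse y (proj₂ 0<y ∘ sym)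
  ... | y⁻¹ , yy⁻¹≈1 = the-satisfies 0# (λ z → z * y ≈ x) (x * y⁻¹ , (begin-equality
    x * y⁻¹ * y    ≈⟨ solve 3 (λ x y z → x :* z :* y := x :* (y :* z)) refl x y y⁻¹ ⟩
    x * (y * y⁻¹)  ≈⟨ *-congˡ yy⁻¹≈1 ⟩
    x * 1#         ≈⟨ *-identityʳ x ⟩
    x              ∎))

  /-pos : ∀ {x y} → 0# < x → 0# < y → 0# < x / y
  /-pos {x} {y} 0<x 0<y = *-cancelˡ-< 0<y
    (<-resp (sym (zeroʳ y)) (trans (sym (/-cancel 0<y)) (*-comm _ y)) 0<x)

  ^-nonNeg : ∀ {x} n → 0# ≤ x → 0# ≤ x ^ n
  ^-nonNeg 0       0≤x = 0≤1
  ^-nonNeg (suc n) 0≤x = *-nonNeg 0≤x (^-nonNeg n 0≤x)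

  ^-pos : ∀ {x} n → 0# < x → 0# < x ^ n
  ^-pos 0       0<x = 0<1
  ^-pos (suc n) 0<x = *-pos 0<x (^-pos n 0<x)

  ^-monoˡ-≤ : ∀ {x y} n → 0# ≤ x → x ≤ y → x ^ n ≤ y ^ n
  ^-monoˡ-≤ 0       0≤x x≤y = ≤.refl
  ^-monoˡ-≤ (suc n) 0≤x x≤y = *-mono-≤ 0≤x x≤y (^-nonNeg n 0≤x) (^-monoˡ-≤ n 0≤x x≤y)

  1^n≈1 : ∀ n → 1# ^ n ≈ 1#
  1^n≈1 0       = refl
  1^n≈1 (suc n) = trans (*-identityˡ _) (1^n≈1 n)

  1≤x^n : ∀ {x} n → 1# ≤ x → 1# ≤ x ^ n
  1≤x^n n 1≤x = ≤-resp (1^n≈1 n) refl (^-monoˡ-≤ n 0≤1 1≤x)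

  1<x^1+n : ∀ {x} n → 1# < x → 1# < x ^ suc n
  1<x^1+n {x} n 1<x = begin-strict
    1#         <⟨ 1<x ⟩
    x          ≈⟨ *-identityʳ x ⟨
    x * 1#     ≤⟨ *-monoˡ-≤ (≤.trans 0≤1 (proj₁ 1<x)) (1≤x^n n (proj₁ 1<x)) ⟩
    x * x ^ n  ∎

  -- Induction: multiplying by `1# + x` keeps the order because that factor is non-negative, and the
  -- surplus n x² is dropped. Negative `x` down to -1 is allowed since the tail bounds and
  -- `small-power` use it there.
  bernoulli : ∀ {x} n → 0# ≤ 1# + x → 1# + fromℕ n * x ≤ (1# + x) ^ n
  bernoulli {x} 0 0≤1+x =
    ≤.reflexive (solve 1 (λ x → con (+ 1) :+ con (+ 0) :* x := con (+ 1)) refl x)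
  bernoulli {x} (suc n) 0≤1+x = begin
    1# + (1# + fromℕ n) * x         ≤⟨ ≤-by (*-nonNeg (0≤n·x² n) 0≤1) (solve 2 (λ x n →
                                        n :* (x :* x) :* con (+ 1) :=
                                        (con (+ 1) :+ x) :* (con (+ 1) :+ n :* x)
                                          :- (con (+ 1) :+ (con (+ 1) :+ n) :* x))
                                        refl x (fromℕ n)) ⟩
    (1# + x) * (1# + fromℕ n * x)   ≤⟨ *-monoˡ-≤ 0≤1+x (bernoulli n 0≤1+x) ⟩
    (1# + x) * (1# + x) ^ n         ∎
    where
    0≤x² : 0# ≤ x * x
    0≤x² with total 0# x
    ... | inj₁ 0≤x = *-nonNeg 0≤x 0≤x
    ... | inj₂ x≤0 = ≤-by (*-nonNeg (≤⇒0≤ x≤0) (≤⇒0≤ x≤0))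
      (solve 1 (λ x → (con (+ 0) :- x) :* (con (+ 0) :- x) := x :* x :- con (+ 0)) refl x)

    0≤n·x² : ∀ n → 0# ≤ fromℕ n * (x * x)
    0≤n·x² 0       = ≤.reflexive (sym (zeroˡ _))
    0≤n·x² (suc n) = ≤-by (+-nonNeg 0≤x² (0≤n·x² n)) (solve 2 (λ x n →
      x :* x :+ n :* (x :* x) := (con (+ 1) :+ n) :* (x :* x) :- con (+ 0)) refl x (fromℕ n))

  fromℕ-+ : ∀ m n → fromℕ (m ℕ.+ n) ≈ fromℕ m + fromℕ n
  fromℕ-+ = ×-homo-+ 1#

  fromℕ-* : ∀ m n → fromℕ (m ℕ.* n) ≈ fromℕ m * fromℕ n
  fromℕ-* = ×1-homo-*

  fromℕ-1 : fromℕ 1 ≈ 1#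
  fromℕ-1 = +-identityʳ 1#

  0≤fromℕ : ∀ n → 0# ≤ fromℕ n
  0≤fromℕ 0       = ≤.refl
  0≤fromℕ (suc n) = +-nonNeg 0≤1 (0≤fromℕ n)

  0<fromℕ : ∀ n → 0# < fromℕ (suc n)
  0<fromℕ n = +-pos 0<1 (0≤fromℕ n)

  fromℕ-mono-≤ : ∀ {m n} → m ℕ.≤ n → fromℕ m ≤ fromℕ n
  fromℕ-mono-≤ {n = n} z≤n = 0≤fromℕ n
  fromℕ-mono-≤ (s≤s m≤n)   = +-monoʳ-≤ 1# (fromℕ-mono-≤ m≤n)

  fromℕ-mono-< : ∀ {m n} → m ℕ.< n → fromℕ m < fromℕ n
  fromℕ-mono-< {m} {n} m<n = begin-strict
    fromℕ m       <⟨ x<x+1 (fromℕ m) ⟩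
    fromℕ m + 1#  ≈⟨ +-comm _ _ ⟩
    1# + fromℕ m  ≤⟨ fromℕ-mono-≤ m<n ⟩
    fromℕ n       ∎

  fromℕ-cancel-< : ∀ {m n} → fromℕ m < fromℕ n → m ℕ.< n
  fromℕ-cancel-< m<n = ℕ.≰⇒> λ n≤m → <⇒≱ m<n (fromℕ-mono-≤ n≤m)

  fromℕ-cancel-≤ : ∀ {m n} → fromℕ m ≤ fromℕ n → m ℕ.≤ n
  fromℕ-cancel-≤ m≤n = ℕ.≮⇒≥ λ n<m → <⇒≱ (fromℕ-mono-< n<m) m≤n

  abstract
    -- If no natural number exceeded `x`, the naturals would have a supremum s. As n + 1 ≤ s for all
    -- n, s - 1 would be a smaller upper bound.
    archimedean : ∀ x → ∃ λ n → x < fromℕ n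
    archimedean x with em {∃ λ n → x < fromℕ n}
    ... | yes ∃n = ∃n
    ... | no ∄n  =
      let s , s-upper , s-least = complete (λ y → ∃ λ n → y ≈ fromℕ n) (0# , 0 , refl)
            (x , λ { y (n , y≈n) → ≤-resp (sym y≈n) refl (≮⇒≥ λ x<n → ∄n (n , x<n)) })
          s-1-upper = λ { y (n , y≈n) → begin
            y                    ≈⟨ y≈n ⟩
            fromℕ n              ≈⟨ solve 1 (λ n → n := con (+ 1) :+ n :- con (+ 1)) refl (fromℕ n) ⟩
            1# + fromℕ n - 1#    ≤⟨ +-mono-≤ (s-upper _ (suc n , refl)) ≤.refl ⟩
            s - 1#               ∎ }
      in ⊥-elim (<⇒≱ (<-by 0<1 (solve 1 (λ s → con (+ 1) := s :- (s :- con (+ 1))) refl s))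
                     (s-least (s - 1#) s-1-upper))

  abstract
    archimedean-* : ∀ {x} y → 0# < x → ∃ λ n → y < fromℕ n * x
    archimedean-* {x} y 0<x with positive-inverse 0<x
    ... | x⁻¹ , 0<x⁻¹ , xx⁻¹≈1 with archimedean (y * x⁻¹)
    ...   | n , yx⁻¹<n = n , (begin-strict
      y              ≈⟨ *-identityʳ y ⟨
      y * 1#         ≈⟨ *-congˡ xx⁻¹≈1 ⟨
      y * (x * x⁻¹)  ≈⟨ solve 3 (λ x y z → y :* (x :* z) := x :* (y :* z)) refl x y x⁻¹ ⟩
      x * (y * x⁻¹)  <⟨ *-monoˡ-< 0<x yx⁻¹<n ⟩
      x * fromℕ n    ≈⟨ *-comm _ _ ⟩
      fromℕ n * x    ∎)

  -- Comparing logarithms through integer exponents costs a rounding error that does not grow with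
  -- `n`. Were y < x, the gap n (x - y) would outgrow any such constant.
  ≤-by-scaling : ∀ {x y} c → (∀ n → fromℕ n * x ≤ fromℕ n * y + c) → x ≤ y
  ≤-by-scaling {x} {y} c nx≤ny+c = ≮⇒≥ λ y<x →
    let n , c<n[x-y] = archimedean-* c (<⇒0< y<x)
    in <⇒≱ c<n[x-y] (≤-by (≤⇒0≤ (nx≤ny+c n)) (solve 4 (λ n x y c →
         n :* y :+ c :- n :* x := c :- n :* (x :- y)) refl (fromℕ n) x y c))

  abstract
    floor : ∀ {x} → 0# ≤ x → ∃ λ n → fromℕ n ≤ x × x < fromℕ (suc n)
    floor {x} 0≤x = let n , x<n = archimedean x in search n x<n
      where
      search : ∀ n → x < fromℕ n → ∃ λ n → fromℕ n ≤ x × x < fromℕ (suc n)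
      search 0       x<0 = ⊥-elim (<⇒≱ x<0 0≤x)
      search (suc n) x<1+n = [ (λ n≤x → n , n≤x , x<1+n) , search n ]′ (fromℕ n ≤? x)

-- The binary logarithm on [1,∞)

module BinaryLogarithm (em : ExcludedMiddle 0ℓ) (R : RealField) where
  open Real em R
  open IntegerCoefficients R
  open OrderedField em R
  open Exp commutativeSemiring using (^-congˡ; ^-congʳ; ^-homo-*; ^-assocʳ; ^-distrib-*)
  open ≤-Reasoning

  two : ℝ
  two = fromℕ 2

  1<two : 1# < two
  1<two = <-resp fromℕ-1 refl (fromℕ-mono-< {1} {2} ℕ.≤-refl)

  1≤two : 1# ≤ two
  1≤two = proj₁ 1<two

  two≈1+1 : two ≈ 1# + 1#
  two≈1+1 = +-congˡ fromℕ-1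

  ^-monoʳ-≤ : ∀ {x m n} → 1# ≤ x → m ℕ.≤ n → x ^ m ≤ x ^ n
  ^-monoʳ-≤ {n = n} 1≤x z≤n = 1≤x^n n 1≤x
  ^-monoʳ-≤ 1≤x (s≤s m≤n)   = *-monoˡ-≤ (≤.trans 0≤1 1≤x) (^-monoʳ-≤ 1≤x m≤n)

  two^-mono-< : ∀ {m n} → m ℕ.< n → two ^ m < two ^ n
  two^-mono-< {m} {n} m<n = begin-strict
    two ^ m        ≈⟨ *-identityʳ _ ⟨
    two ^ m * 1#   <⟨ *-monoˡ-< (^-pos m (0<fromℕ 1)) 1<two ⟩
    two ^ m * two  ≈⟨ *-comm _ _ ⟩
    two ^ suc m    ≤⟨ ^-monoʳ-≤ 1≤two m<n ⟩
    two ^ n        ∎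

  two^-cancel-≤ : ∀ {m n} → two ^ m ≤ two ^ n → m ℕ.≤ n
  two^-cancel-≤ 2^m≤2^n = ℕ.≮⇒≥ λ n<m → <⇒≱ (two^-mono-< n<m) 2^m≤2^n

  n≤two^n : ∀ n → fromℕ n ≤ two ^ n
  n≤two^n n = begin
    fromℕ n
      ≤⟨ ≤-by 0≤1 (solve 1 (λ n → con (+ 1) := con (+ 1) :+ n :* con (+ 1) :- n) refl (fromℕ n)) ⟩
    1# + fromℕ n * 1#  ≤⟨ bernoulli n (+-nonNeg 0≤1 0≤1) ⟩
    (1# + 1#) ^ n      ≈⟨ ^-congˡ n two≈1+1 ⟨
    two ^ n            ∎

  abstract
    below-two^ : ∀ x → ∃ λ n → x < two ^ n
    below-two^ x = let n , x<n = archimedean x in n , <-≤-trans x<n (n≤two^n n)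

  abstract
    floor-log : ∀ {z} → 1# ≤ z → ∃ λ a → two ^ a ≤ z × z < two ^ suc a
    floor-log {z} 1≤z = let n , z<2^n = below-two^ z in search n z<2^n
      where
      search : ∀ n → z < two ^ n → ∃ λ a → two ^ a ≤ z × z < two ^ suc a
      search 0       z<1 = ⊥-elim (<⇒≱ z<1 1≤z)
      search (suc n) z<2^1+n =
        [ (λ 2^n≤z → n , 2^n≤z , z<2^1+n) , search n ]′ (two ^ n ≤? z)

  -- ℓ is the cut of the fractions a/b with 2^a ≤ x^b; 1 ≤ x lets a and b be natural.
  record IsLog (x ℓ : ℝ) : Set where
    field
      1≤x   : 1# ≤ x
      lower : ∀ a b → two ^ a ≤ x ^ b → fromℕ a ≤ fromℕ b * ℓ
      upper : ∀ a b → x ^ b ≤ two ^ a → fromℕ b * ℓ ≤ fromℕ a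

    0<x : 0# < x
    0<x = <-≤-trans 0<1 1≤x

    0≤ℓ : 0# ≤ ℓ
    0≤ℓ = ≤-resp refl (trans (*-congʳ fromℕ-1) (*-identityˡ ℓ)) (lower 0 1 (1≤x^n 1 1≤x))

    abstract
      -- One integer brackets both `x ^ n` (between powers of two) and `fromℕ n * ℓ`. It carries
      -- inequalities between powers over to logarithms with an error of at most 1.
      floor-^ : ∀ n → ∃ λ a → two ^ a ≤ x ^ n × x ^ n ≤ two ^ suc a
                          × fromℕ a ≤ fromℕ n * ℓ × fromℕ n * ℓ ≤ fromℕ (suc a)
      floor-^ n = let a , 2^a≤x^n , x^n<2^1+a = floor-log (1≤x^n n 1≤x) in
        a , 2^a≤x^n , proj₁ x^n<2^1+a , lower a n 2^a≤x^n , upper (suc a) n (proj₁ x^n<2^1+a)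

  open IsLog

  IsLog-resp : ∀ {x y ℓ k} → x ≈ y → ℓ ≈ k → IsLog x ℓ → IsLog y k
  IsLog-resp x≈y ℓ≈k log = record
    { 1≤x   = ≤-resp refl x≈y (1≤x log)
    ; lower = λ a b h → ≤-resp refl (*-congˡ ℓ≈k) (lower log a b (≤-resp refl (^-congˡ b (sym x≈y)) h))
    ; upper = λ a b h → ≤-resp (*-congˡ ℓ≈k) refl (upper log a b (≤-resp (^-congˡ b (sym x≈y)) refl h))
    }

  -- Raise the first bound to the power `b` and the second to `d`, then compare exponents of two. In
  -- other words c/d ≤ a/b: the two sides of the cut do not overlap.
  cross-≤ : ∀ {x} a b c d → 1# ≤ x → two ^ c ≤ x ^ d → x ^ b ≤ two ^ a → c ℕ.* b ℕ.≤ a ℕ.* d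
  cross-≤ {x} a b c d 1≤x 2^c≤x^d x^b≤2^a = two^-cancel-≤ (begin
    two ^ (c ℕ.* b)  ≈⟨ ^-assocʳ two c b ⟨
    (two ^ c) ^ b    ≤⟨ ^-monoˡ-≤ b (^-nonNeg c (0≤fromℕ 2)) 2^c≤x^d ⟩
    (x ^ d) ^ b      ≈⟨ ^-assocʳ x d b ⟩
    x ^ (d ℕ.* b)    ≡⟨ ≡.cong (x ^_) (ℕ.*-comm d b) ⟩
    x ^ (b ℕ.* d)    ≈⟨ ^-assocʳ x b d ⟨
    (x ^ b) ^ d      ≤⟨ ^-monoˡ-≤ d (^-nonNeg b (≤.trans 0≤1 1≤x)) x^b≤2^a ⟩
    (two ^ a) ^ d    ≈⟨ ^-assocʳ two a d ⟩
    two ^ (a ℕ.* d)  ∎)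

  log-exists : ∀ {x} → 1# ≤ x → ∃ (IsLog x)
  log-exists {x} 1≤x = ℓ , record { 1≤x = 1≤x ; lower = ℓ-lower ; upper = ℓ-upper }
    where
    -- The lower side of the cut, closed downwards: `s` is at most a fraction a/(b+1) with 2^a ≤
    -- x^(b+1), stated without division. The shift keeps denominators positive.
    Below : Pred ℝ 0ℓ
    Below s = ∃ λ a → ∃ λ b → fromℕ (suc b) * s ≤ fromℕ a × two ^ a ≤ x ^ suc b

    upperBound : ∀ a b → x ^ suc b ≤ two ^ a → IsUpperBound Below (fromℕ a / fromℕ (suc b))
    upperBound a b x^b≤2^a s (c , d , ds≤c , 2^c≤x^d) =
      *-cancelˡ-≤ (0<fromℕ b) (*-cancelˡ-≤ (0<fromℕ d) (begin
        D * (B * s)             ≈⟨ solve 3 (λ b d s → d :* (b :* s) := b :* (d :* s)) refl B D s ⟩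
        B * (D * s)             ≤⟨ *-monoˡ-≤ (0≤fromℕ (suc b)) ds≤c ⟩
        B * fromℕ c             ≈⟨ trans (*-comm _ _) (sym (fromℕ-* c (suc b))) ⟩
        fromℕ (c ℕ.* suc b)     ≤⟨ fromℕ-mono-≤ (cross-≤ a (suc b) c (suc d) 1≤x 2^c≤x^d x^b≤2^a) ⟩
        fromℕ (a ℕ.* suc d)     ≈⟨ trans (fromℕ-* a (suc d)) (*-comm _ _) ⟩
        D * fromℕ a             ≈⟨ *-congˡ (trans (*-comm _ _) (/-cancel (0<fromℕ b))) ⟨
        D * (B * (fromℕ a / B)) ∎))
      where
      B = fromℕ (suc b)
      D = fromℕ (suc d)

    sup : ∃ (IsSupremum Below)
    sup = complete Below
      (0# , 0 , 0 , ≤.reflexive (zeroʳ _) , 1≤x^n 1 1≤x)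
      (let K , x<2^K = below-two^ x
       in _ , upperBound K 0 (≤-resp (sym (*-identityʳ x)) refl (proj₁ x<2^K)))

    ℓ = proj₁ sup

    ℓ-lower : ∀ a b → two ^ a ≤ x ^ b → fromℕ a ≤ fromℕ b * ℓ
    ℓ-lower a 0 2^a≤1 =
      ≤-resp refl (sym (zeroˡ ℓ)) (fromℕ-mono-≤ {a} {0} (two^-cancel-≤ {a} {0} 2^a≤1))
    ℓ-lower a (suc b) 2^a≤x^b = begin
      fromℕ a                  ≈⟨ trans (*-comm _ _) (/-cancel (0<fromℕ b)) ⟨
      B * (fromℕ a / B)        ≤⟨ *-monoˡ-≤ (0≤fromℕ (suc b)) (proj₁ (proj₂ sup) _
                      (a , b , ≤.reflexive (trans (*-comm _ _) (/-cancel (0<fromℕ b))) , 2^a≤x^b)) ⟩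
      B * ℓ                    ∎
      where B = fromℕ (suc b)

    ℓ-upper : ∀ a b → x ^ b ≤ two ^ a → fromℕ b * ℓ ≤ fromℕ a
    ℓ-upper a 0 _ = ≤-resp (sym (zeroˡ ℓ)) refl (0≤fromℕ a)
    ℓ-upper a (suc b) x^b≤2^a = begin
      B * ℓ              ≤⟨ *-monoˡ-≤ (0≤fromℕ (suc b)) (proj₂ (proj₂ sup) _ (upperBound a b x^b≤2^a)) ⟩
      B * (fromℕ a / B)  ≈⟨ trans (*-comm _ _) (/-cancel (0<fromℕ b)) ⟩
      fromℕ a            ∎
      where B = fromℕ (suc b)

  log-mono-≤ : ∀ {x y ℓ k} → IsLog x ℓ → IsLog y k → x ≤ y → ℓ ≤ k
  log-mono-≤ {ℓ = ℓ} {k} log-x log-y x≤y = ≤-by-scaling 1# λ n →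
    let a , 2^a≤x^n , _ , _ , nℓ≤1+a = floor-^ log-x n in begin
      fromℕ n * ℓ       ≤⟨ nℓ≤1+a ⟩
      1# + fromℕ a      ≤⟨ +-monoʳ-≤ 1# (lower log-y a n
                            (≤.trans 2^a≤x^n (^-monoˡ-≤ n (proj₁ (0<x log-x)) x≤y))) ⟩
      1# + fromℕ n * k  ≈⟨ +-comm _ _ ⟩
      fromℕ n * k + 1#  ∎

  log-unique : ∀ {x y ℓ k} → IsLog x ℓ → IsLog y k → x ≈ y → ℓ ≈ k
  log-unique log-x log-y x≈y = ≤.antisym
    (log-mono-≤ log-x log-y (≤.reflexive x≈y)) (log-mono-≤ log-y log-x (≤.reflexive (sym x≈y)))

  -- The cut condition on `x * y` does not split into conditions on `x` and `y`, so it is not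
  -- verified directly. Instead the logarithm `w` that the product has anyway is compared with
  -- `ℓ + k`. Each factor is rounded once, whence the slack `1# + 1#`.
  log-* : ∀ {x y ℓ k} → IsLog x ℓ → IsLog y k → IsLog (x * y) (ℓ + k)
  log-* {x} {y} {ℓ} {k} log-x log-y = IsLog-resp refl w≈ℓ+k log-xy
    where
    1≤xy : 1# ≤ x * y
    1≤xy = ≤-resp (*-identityˡ 1#) refl (*-mono-≤ 0≤1 (1≤x log-x) 0≤1 (1≤x log-y))

    w = proj₁ (log-exists 1≤xy)
    log-xy = proj₂ (log-exists 1≤xy)

    w≤ℓ+k : w ≤ ℓ + k
    w≤ℓ+k = ≤-by-scaling (1# + 1#) λ n →
      let a , _ , x^n≤2^1+a , a≤nℓ , _ = floor-^ log-x n
          b , _ , y^n≤2^1+b , b≤nk , _ = floor-^ log-y n in begin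
        fromℕ n * w                       ≤⟨ upper log-xy (suc a ℕ.+ suc b) n (begin
          (x * y) ^ n                ≈⟨ ^-distrib-* x y n ⟩
          x ^ n * y ^ n              ≤⟨ *-mono-≤ (^-nonNeg n (proj₁ (0<x log-x))) x^n≤2^1+a
                                                 (^-nonNeg n (proj₁ (0<x log-y))) y^n≤2^1+b ⟩
          two ^ suc a * two ^ suc b  ≈⟨ ^-homo-* two (suc a) (suc b) ⟨
          two ^ (suc a ℕ.+ suc b)    ∎) ⟩
        fromℕ (suc a ℕ.+ suc b)           ≈⟨ fromℕ-+ (suc a) (suc b) ⟩
        (1# + fromℕ a) + (1# + fromℕ b)   ≤⟨ +-mono-≤ (+-monoʳ-≤ 1# a≤nℓ) (+-monoʳ-≤ 1# b≤nk) ⟩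
        (1# + fromℕ n * ℓ) + (1# + fromℕ n * k)
          ≈⟨ solve 3 (λ n ℓ k → (con (+ 1) :+ n :* ℓ) :+ (con (+ 1) :+ n :* k) :=
                                n :* (ℓ :+ k) :+ (con (+ 1) :+ con (+ 1))) refl (fromℕ n) ℓ k ⟩
        fromℕ n * (ℓ + k) + (1# + 1#)     ∎

    ℓ+k≤w : ℓ + k ≤ w
    ℓ+k≤w = ≤-by-scaling (1# + 1#) λ n →
      let a , 2^a≤x^n , _ , _ , nℓ≤1+a = floor-^ log-x n
          b , 2^b≤y^n , _ , _ , nk≤1+b = floor-^ log-y n in begin
        fromℕ n * (ℓ + k)                 ≈⟨ distribˡ _ ℓ k ⟩
        fromℕ n * ℓ + fromℕ n * k         ≤⟨ +-mono-≤ nℓ≤1+a nk≤1+b ⟩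
        (1# + fromℕ a) + (1# + fromℕ b)   ≈⟨ solve 2 (λ a b → (con (+ 1) :+ a) :+ (con (+ 1) :+ b) :=
                                      con (+ 1) :+ con (+ 1) :+ (a :+ b)) refl (fromℕ a) (fromℕ b) ⟩
        1# + 1# + (fromℕ a + fromℕ b)     ≈⟨ +-congˡ (fromℕ-+ a b) ⟨
        1# + 1# + fromℕ (a ℕ.+ b)         ≤⟨ +-monoʳ-≤ (1# + 1#) (lower log-xy (a ℕ.+ b) n (begin
          two ^ (a ℕ.+ b)     ≈⟨ ^-homo-* two a b ⟩
          two ^ a * two ^ b   ≤⟨ *-mono-≤ (^-nonNeg a (0≤fromℕ 2)) 2^a≤x^n
                                          (^-nonNeg b (0≤fromℕ 2)) 2^b≤y^n ⟩
          x ^ n * y ^ n       ≈⟨ ^-distrib-* x y n ⟨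
          (x * y) ^ n         ∎)) ⟩
        1# + 1# + fromℕ n * w             ≈⟨ +-comm _ _ ⟩
        fromℕ n * w + (1# + 1#)           ∎

    w≈ℓ+k : w ≈ ℓ + k
    w≈ℓ+k = ≤.antisym w≤ℓ+k ℓ+k≤w

  log-two^ : ∀ n → IsLog (two ^ n) (fromℕ n)
  log-two^ n = record
    { 1≤x   = 1≤x^n n 1≤two
    ; lower = λ a b 2^a≤2^nb → ≤-resp refl (fromℕ-* b n) (fromℕ-mono-≤ {a} {b ℕ.* n}
        (two^-cancel-≤ {a} {b ℕ.* n} (≤-resp refl (2^nb≈2^bn b) 2^a≤2^nb)))
    ; upper = λ a b 2^nb≤2^a → ≤-resp (fromℕ-* b n) refl (fromℕ-mono-≤ {b ℕ.* n} {a}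
        (two^-cancel-≤ {b ℕ.* n} {a} (≤-resp (2^nb≈2^bn b) refl 2^nb≤2^a)))
    }
    where
    2^nb≈2^bn : ∀ b → (two ^ n) ^ b ≈ two ^ (b ℕ.* n)
    2^nb≈2^bn b = trans (^-assocʳ two n b) (^-congʳ two (ℕ.*-comm n b))

  log-^ : ∀ {x ℓ} n → IsLog x ℓ → IsLog (x ^ n) (fromℕ n * ℓ)
  log-^ {ℓ = ℓ} 0 log-x = IsLog-resp refl (sym (zeroˡ ℓ)) (log-two^ 0)
  log-^ {ℓ = ℓ} (suc n) log-x = IsLog-resp refl
    (solve 2 (λ n ℓ → ℓ :+ n :* ℓ := (con (+ 1) :+ n) :* ℓ) refl (fromℕ n) ℓ)
    (log-* log-x (log-^ n log-x))

  -- Bernoulli's inequality at x - 1, with n (x - 1) > 1. A power reaching 2 is what bounds the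
  -- logarithm of `x` away from 0.
  large-power : ∀ {x} → 1# < x → ∃ λ n → two ≤ x ^ n
  large-power {x} 1<x =
    let n , 1<n[x-1] = archimedean-* 1# (<⇒0< 1<x) in n , (begin
      two                        ≈⟨ two≈1+1 ⟩
      1# + 1#                    ≤⟨ +-monoʳ-≤ 1# (proj₁ 1<n[x-1]) ⟩
      1# + fromℕ n * (x - 1#)    ≤⟨ bernoulli n (≤-resp refl (sym 1+[x-1]≈x) (≤.trans 0≤1 (proj₁ 1<x))) ⟩
      (1# + (x - 1#)) ^ n        ≈⟨ ^-congˡ n 1+[x-1]≈x ⟩
      x ^ n                      ∎)
    where
    1+[x-1]≈x : 1# + (x - 1#) ≈ x
    1+[x-1]≈x = solve 1 (λ x → con (+ 1) :+ (x :- con (+ 1)) := x) refl x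

  log-pos : ∀ {x ℓ} → 1# < x → IsLog x ℓ → 0# < ℓ
  log-pos {x} {ℓ} 1<x log-x = ≰⇒> λ ℓ≤0 → let n , 2≤x^n = large-power 1<x in
    <⇒≱ 0<1 (begin
      1#             ≈⟨ fromℕ-1 ⟨
      fromℕ 1        ≤⟨ lower log-x 1 n (≤-resp (sym (*-identityʳ two)) refl 2≤x^n) ⟩
      fromℕ n * ℓ    ≤⟨ *-monoˡ-≤ (0≤fromℕ n) ℓ≤0 ⟩
      fromℕ n * 0#   ≈⟨ zeroʳ _ ⟩
      0#             ∎)

  log-mono-< : ∀ {x y ℓ k} → IsLog x ℓ → IsLog y k → x < y → ℓ < k
  log-mono-< {x} {y} {ℓ} {k} log-x log-y x<y = begin-strict
    ℓ       ≈⟨ +-identityˡ ℓ ⟨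
    0# + ℓ  <⟨ +-mono-<-≤ (log-pos 1<y/x log-y/x) ≤.refl ⟩
    j + ℓ   ≈⟨ log-unique (log-* log-y/x log-x) log-y (/-cancel (0<x log-x)) ⟩
    k       ∎
    where
    1<y/x : 1# < y / x
    1<y/x = *-cancelˡ-< (0<x log-x) (<-resp (sym (*-identityʳ x))
      (trans (sym (/-cancel (0<x log-x))) (*-comm _ x)) x<y)

    j = proj₁ (log-exists (proj₁ 1<y/x))
    log-y/x = proj₂ (log-exists (proj₁ 1<y/x))

  log-cancel-≤ : ∀ {x y ℓ k} → IsLog x ℓ → IsLog y k → ℓ ≤ k → x ≤ y
  log-cancel-≤ log-x log-y ℓ≤k = ≮⇒≥ λ y<x → <⇒≱ (log-mono-< log-y log-x y<x) ℓ≤k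

  log-injective : ∀ {x y ℓ k} → IsLog x ℓ → IsLog y k → ℓ ≈ k → x ≈ y
  log-injective log-x log-y ℓ≈k = ≤.antisym
    (log-cancel-≤ log-x log-y (≤.reflexive ℓ≈k)) (log-cancel-≤ log-y log-x (≤.reflexive (sym ℓ≈k)))

  -- p = (1 - 1/(2n))⁻¹ works: (1 - 1/(2n))^n ≥ 1/2 gives p^n ≤ 2.
  small-power : ∀ n → ∃ λ p → 1# < p × p ^ suc n ≤ two
  small-power n = p , 1<p , *-cancelˡ-≤ (^-pos (suc n) 0<q) (begin
    q ^ suc n * p ^ suc n                ≈⟨ ^-distrib-* q p (suc n) ⟨
    (q * p) ^ suc n                      ≈⟨ trans (^-congˡ (suc n) qp≈1) (1^n≈1 (suc n)) ⟩
    1#                                   ≈⟨ +-identityʳ 1# ⟨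
    1# + 0#                              ≈⟨ +-congˡ (-‿inverseʳ 1#) ⟨
    1# + (1# - 1#)                       ≈⟨ +-congˡ (+-congˡ (-‿cong 2nh≈1)) ⟨
    1# + (1# - (1# + 1#) * N * h)        ≈⟨ solve 2 (λ n h →
                                   con (+ 1) :+ (con (+ 1) :- (con (+ 1) :+ con (+ 1)) :* n :* h) :=
                                  (con (+ 1) :+ n :* (:- h)) :* (con (+ 1) :+ con (+ 1))) refl N h ⟩
    (1# + N * - h) * (1# + 1#)           ≤⟨ *-mono-≤ᵣ (bernoulli (suc n) (proj₁ 0<q)) ⟩
    q ^ suc n * (1# + 1#)                ≈⟨ *-congˡ two≈1+1 ⟨
    q ^ suc n * two                      ∎)
    where
    N = fromℕ (suc n)

    0<2N : 0# < (1# + 1#) * N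
    0<2N = *-pos (+-pos 0<1 0≤1) (0<fromℕ n)

    h = proj₁ (positive-inverse 0<2N)

    0<h : 0# < h
    0<h = proj₁ (proj₂ (positive-inverse 0<2N))

    2nh≈1 : (1# + 1#) * N * h ≈ 1#
    2nh≈1 = proj₂ (proj₂ (positive-inverse 0<2N))

    q = 1# + - h

    0<q : 0# < q
    0<q = <⇒0< (begin-strict
      h
        <⟨ <-by (+-pos 0<h (*-nonNeg (0≤fromℕ n) (+-nonNeg (proj₁ 0<h) (proj₁ 0<h))))
                                  (solve 2 (λ n h → h :+ n :* (h :+ h) :=
                         (con (+ 1) :+ con (+ 1)) :* (con (+ 1) :+ n) :* h :- h) refl (fromℕ n) h) ⟩
      (1# + 1#) * N * h      ≈⟨ 2nh≈1 ⟩
      1#                     ∎)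

    p = proj₁ (positive-inverse 0<q)

    qp≈1 : q * p ≈ 1#
    qp≈1 = proj₂ (proj₂ (positive-inverse 0<q))

    1<p : 1# < p
    1<p = *-cancelˡ-< 0<q (<-resp (sym (*-identityʳ q)) (sym qp≈1)
      (<-by 0<h (solve 1 (λ h → h := con (+ 1) :- (con (+ 1) :+ (:- h))) refl h)))

    *-mono-≤ᵣ : ∀ {x y} → x ≤ y → x * (1# + 1#) ≤ y * (1# + 1#)
    *-mono-≤ᵣ x≤y = ≤-resp (*-comm _ _) (*-comm _ _) (*-monoˡ-≤ (+-nonNeg 0≤1 0≤1) x≤y)

  abstract
    -- Takes the place of continuity at 1: `p` is a factor above 1 whose logarithm is as small as
    -- desired. From p^(n+1) ≤ 2 follows (n+1) j ≤ 1, and `n` is chosen with 1 < n ε.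
    small-log : ∀ {ε} → 0# < ε → ∃ λ p → ∃ λ j → 1# < p × IsLog p j × j ≤ ε
    small-log {ε} 0<ε =
      let n , 1<nε = archimedean-* 1# 0<ε
          p , 1<p , p^1+n≤2 = small-power n
          j , log-p = log-exists (proj₁ 1<p)
      in p , j , 1<p , log-p , *-cancelˡ-≤ (0<fromℕ n) (begin
        fromℕ (suc n) * j   ≤⟨ upper log-p 1 (suc n) (≤-resp refl (sym (*-identityʳ two)) p^1+n≤2) ⟩
        fromℕ 1             ≈⟨ fromℕ-1 ⟩
        1#                  ≤⟨ proj₁ 1<nε ⟩
        fromℕ n * ε         ≤⟨ ≤-by (proj₁ 0<ε) (solve 2 (λ n ε →
                                ε := (con (+ 1) :+ n) :* ε :- n :* ε) refl (fromℕ n) ε) ⟩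
        fromℕ (suc n) * ε   ∎)

  -- `s` is the supremum of the numbers with logarithm at most `t`, and `ℓ` its logarithm. If ℓ < t,
  -- some `p * s` with p > 1 still has logarithm at most `t` and exceeds `s`. If t < ℓ, some `s / p`
  -- is still an upper bound, though smaller than `s`.
  log-surjective : ∀ {t} → 0# ≤ t → ∃ λ x → IsLog x t
  log-surjective {t} 0≤t = s , IsLog-resp refl (≤.antisym ℓ≤t t≤ℓ) log-s
    where
    Below : Pred ℝ 0ℓ
    Below x = ∃ λ ℓ → IsLog x ℓ × ℓ ≤ t

    sup : ∃ (IsSupremum Below)
    sup = complete Below (1# , 0# , log-two^ 0 , 0≤t)
      (let K , t<K = archimedean t
       in two ^ K , λ { x (ℓ , log-x , ℓ≤t) →
            log-cancel-≤ log-x (log-two^ K) (≤.trans ℓ≤t (proj₁ t<K)) })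

    s = proj₁ sup

    s-upper : IsUpperBound Below s
    s-upper = proj₁ (proj₂ sup)

    1≤s : 1# ≤ s
    1≤s = s-upper 1# (0# , log-two^ 0 , 0≤t)

    0<s : 0# < s
    0<s = <-≤-trans 0<1 1≤s

    ℓ = proj₁ (log-exists 1≤s)

    log-s : IsLog s ℓ
    log-s = proj₂ (log-exists 1≤s)

    s<ps : ∀ {p} → 1# < p → s < p * s
    s<ps 1<p = <-resp (*-identityʳ s) (*-comm s _) (*-monoˡ-< 0<s 1<p)

    ℓ≮t : ∀ {p j} → 1# < p → IsLog p j → ¬ (j ≤ t - ℓ)
    ℓ≮t {p} {j} 1<p log-p j≤t-ℓ = <⇒≱ (s<ps 1<p) (s-upper (p * s) (j + ℓ , log-* log-p log-s ,
      ≤-by (≤⇒0≤ j≤t-ℓ) (solve 3 (λ j t ℓ → t :- ℓ :- j := t :- (j :+ ℓ)) refl j t ℓ)))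

    t≮ℓ : ∀ {p j} → 1# < p → IsLog p j → ¬ (j ≤ ℓ - t)
    t≮ℓ {p} {j} 1<p log-p j≤ℓ-t =
      <⇒≱ (s<ps 1<p) (≤-resp refl p[s/p]≈s (*-monoˡ-≤ (proj₁ 0<p) (proj₂ (proj₂ sup) (s / p) s/p-upper)))
      where
      0<p : 0# < p
      0<p = <-trans 0<1 1<p

      p[s/p]≈s : p * (s / p) ≈ s
      p[s/p]≈s = trans (*-comm p _) (/-cancel 0<p)

      s/p-upper : IsUpperBound Below (s / p)
      s/p-upper y (k , log-y , k≤t) = *-cancelˡ-≤ 0<p (≤-resp refl (sym p[s/p]≈s)
        (log-cancel-≤ (log-* log-p log-y) log-s
          (≤-by (+-nonNeg (≤⇒0≤ j≤ℓ-t) (≤⇒0≤ k≤t)) (solve 4 (λ j k t ℓ →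
            (ℓ :- t :- j) :+ (t :- k) := ℓ :- (j :+ k)) refl j k t ℓ))))

    t≤ℓ : t ≤ ℓ
    t≤ℓ = ≮⇒≥ λ ℓ<t → let _ , _ , 1<p , log-p , j≤t-ℓ = small-log (<⇒0< ℓ<t) in ℓ≮t 1<p log-p j≤t-ℓ

    ℓ≤t : ℓ ≤ t
    ℓ≤t = ≮⇒≥ λ t<ℓ → let _ , _ , 1<p , log-p , j≤ℓ-t = small-log (<⇒0< t<ℓ) in t≮ℓ 1<p log-p j≤ℓ-t

-- Identification with the exponential defined by rational powers

module Exponential (em : ExcludedMiddle 0ℓ) (R : RealField) where
  open Real em R
  open IntegerCoefficients R
  open OrderedField em R
  open BinaryLogarithm em R
  open IsLog
  open ≤-Reasoning

  RationalPowers : ℝ → Pred ℝ 0ℓ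
  RationalPowers t y = ∃ λ r → fromℚ r ≤ t × IsRationalPower r y

  y^1+n<1 : ∀ {y} n → 0# < y → y < 1# → y ^ suc n < 1#
  y^1+n<1 {y} n 0<y y<1 = begin-strict
    y * y ^ n    ≤⟨ *-monoˡ-≤ (proj₁ 0<y) (^-monoˡ-≤ n (proj₁ 0<y) (proj₁ y<1)) ⟩
    y * 1# ^ n   ≈⟨ trans (*-congˡ (1^n≈1 n)) (*-identityʳ y) ⟩
    y            <⟨ y<1 ⟩
    1#           ∎

  -- A root of a number ≥ 1 is itself ≥ 1 and so has a logarithm. The equation for `y` puts the
  -- fraction a/(d+1) on both sides of the cut, which pins that logarithm down.
  rationalPower⇒log : ∀ {a d y} → 0# < y → y ^ suc d ≈ two ^ a → IsLog y (fromℕ a / fromℕ (suc d))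
  rationalPower⇒log {a} {d} {y} 0<y y^b≈2^a = IsLog-resp refl k≈a/b log-y
    where
    1≤y : 1# ≤ y
    1≤y = ≮⇒≥ λ y<1 → <⇒≱ (y^1+n<1 d 0<y y<1)
      (≤-resp refl (sym y^b≈2^a) (1≤x^n a 1≤two))

    k = proj₁ (log-exists 1≤y)

    log-y : IsLog y k
    log-y = proj₂ (log-exists 1≤y)

    k≈a/b : k ≈ fromℕ a / fromℕ (suc d)
    k≈a/b = *-cancelˡ-≈ (0<fromℕ d) (begin-equality
      fromℕ (suc d) * k
        ≈⟨ ≤.antisym (upper log-y a (suc d) (≤.reflexive y^b≈2^a))
                                               (lower log-y a (suc d) (≤.reflexive (sym y^b≈2^a))) ⟩
      fromℕ a                                    ≈⟨ trans (*-comm _ _) (/-cancel (0<fromℕ d)) ⟨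
      fromℕ (suc d) * (fromℕ a / fromℕ (suc d))  ∎)

  log⇒rationalPower : ∀ {r y} → ℚ.NonNegative r → IsLog y (fromℚ r) → IsRationalPower r y
  log⇒rationalPower {mkℚ (+ a) d _} _ log-y = 0<x log-y ,
    log-injective (log-^ (suc d) log-y) (log-two^ a) (trans (*-comm _ _) (/-cancel (0<fromℕ d)))

  -- Powers with negative exponent may fall outside the domain of the logarithm. This bound keeps
  -- them from affecting a supremum that is at least 1.
  negativePower≤1 : ∀ {n d y} → y ^ suc d ≈ 1# / two ^ suc n → y ≤ 1#
  negativePower≤1 {n} {d} {y} y^b≈1/2^a = ≮⇒≥ λ 1<y → <⇒≱ (1<x^1+n d 1<y)
    (≤-resp (sym y^b≈1/2^a) refl (*-cancelˡ-≤ 0<2^a (begin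
      two ^ suc n * (1# / two ^ suc n)  ≈⟨ trans (*-comm _ _) (/-cancel 0<2^a) ⟩
      1#                                ≤⟨ 1≤x^n (suc n) 1≤two ⟩
      two ^ suc n                       ≈⟨ *-identityʳ _ ⟨
      two ^ suc n * 1#                  ∎)))
    where
    0<2^a : 0# < two ^ suc n
    0<2^a = ^-pos (suc n) (0<fromℕ 1)

  -- Rationals are stored in lowest terms; `g` is the common factor that was cancelled from a/(n+1).
  fromℚ-scaled : ∀ {r a} n g → ℚ.NonNegative r → ↥ r ℤ.* + g ≡ + a → ↧ r ℤ.* + g ≡ + suc n →
                 fromℚ r * fromℕ (suc n) ≈ fromℕ a
  fromℚ-scaled {mkℚ (+ p) d _} {a} n g _ pg≡a dg≡n = begin-equality
    P / D * fromℕ (suc n)        ≈⟨ *-congˡ (reflexive (≡.cong fromℤ dg≡n)) ⟨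
    P / D * fromℤ (+ suc d ℤ.* + g)
      ≈⟨ *-congˡ (trans (reflexive (≡.cong fromℤ (≡.sym (ℤ.pos-* (suc d) g)))) (fromℕ-* (suc d) g)) ⟩
    P / D * (D * G)              ≈⟨ *-assoc _ D G ⟨
    P / D * D * G                ≈⟨ *-congʳ (/-cancel (0<fromℕ d)) ⟩
    P * G                        ≈⟨ fromℕ-* p g ⟨
    fromℕ (p ℕ.* g)              ≡⟨ ≡.cong fromℤ (≡.trans (ℤ.pos-* p g) pg≡a) ⟩
    fromℕ a                      ∎
    where
    P = fromℕ p
    D = fromℕ (suc d)
    G = fromℕ g

  abstract
    fraction : ∀ a n → ∃ λ r → ℚ.NonNegative r × fromℚ r * fromℕ (suc n) ≈ fromℕ a
    fraction a n = ℚ.normalize a (suc n) , ℚ.normalize-nonNeg a (suc n) ,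
      fromℚ-scaled {ℚ.normalize a (suc n)} {a} n (gcd a (suc n))
        (ℚ.normalize-nonNeg a (suc n)) (ℚ.↥-normalize a (suc n)) (ℚ.↧-normalize a (suc n))

  -- `r` is t rounded down to a multiple of 1/(m+1). It loses less than 1/(m+1), while `t - k`
  -- exceeds 1/m.
  scaled-between : ∀ {k t r} m a → 1# < fromℕ m * (t - k) → k < t →
                   fromℕ a ≤ fromℕ (suc m) * t → fromℕ (suc m) * t < fromℕ (suc a) →
                   fromℚ r * fromℕ (suc m) ≈ fromℕ a → k < fromℚ r × fromℚ r ≤ t
  scaled-between {k} {t} {r} m a 1<m[t-k] k<t a≤Mt Mt<1+a rM≈a =
    *-cancelˡ-< (0<fromℕ m) (<-resp refl (sym Mr≈a) Mk<a) ,
    *-cancelˡ-≤ (0<fromℕ m) (≤-resp (sym Mr≈a) refl a≤Mt)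
    where
    Mr≈a : fromℕ (suc m) * fromℚ r ≈ fromℕ a
    Mr≈a = trans (*-comm _ _) rM≈a

    Mk<a : fromℕ (suc m) * k < fromℕ a
    Mk<a = <-by (+-pos (<⇒0< 1<m[t-k]) (+-nonNeg (≤⇒0≤ (proj₁ k<t)) (≤⇒0≤ (proj₁ Mt<1+a))))
      (solve 4 (λ m k t a →
        (m :* (t :- k) :- con (+ 1)) :+ ((t :- k) :+ (con (+ 1) :+ a :- (con (+ 1) :+ m) :* t)) :=
        a :- (con (+ 1) :+ m) :* k) refl (fromℕ m) k t (fromℕ a))

  abstract
    rational-between : ∀ {k t} → 0# ≤ t → k < t →
                       ∃ λ r → ℚ.NonNegative r × k < fromℚ r × fromℚ r ≤ t
    rational-between {k} {t} 0≤t k<t =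
      let m , 1<m[t-k]      = archimedean-* 1# (<⇒0< k<t)
          a , a≤Mt , Mt<1+a = floor (*-nonNeg (0≤fromℕ (suc m)) 0≤t)
          r , 0≤r , rM≈a    = fraction a m
      in r , 0≤r , scaled-between {k} {t} {r} m a 1<m[t-k] k<t a≤Mt Mt<1+a rM≈a

  -- For minimality, an upper bound u < x would have a logarithm k < t. A rational r with k < r ≤ t
  -- then yields a power in the set whose logarithm is above that of `u`.
  log⇒supremum : ∀ {x t} → IsLog x t → IsSupremum (RationalPowers t) x
  log⇒supremum {x} {t} log-x = isUpperBound , λ u u-upper → ≮⇒≥ (u≮x u u-upper)
    where
    isUpperBound : IsUpperBound (RationalPowers t) x
    isUpperBound y (mkℚ (+ a) d _ , r≤t , 0<y , y^b≈2^a) = log-cancel-≤ (rationalPower⇒log {a} {d} 0<y y^b≈2^a) log-x r≤t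
    isUpperBound y (mkℚ -[1+ n ] d _ , _ , _ , y^b≈2^-a) = ≤.trans (negativePower≤1 {n} {d} y^b≈2^-a) (1≤x log-x)

    0/1≈0 : 0# / fromℕ 1 ≈ 0#
    0/1≈0 = begin-equality
      0# / fromℕ 1              ≈⟨ *-identityʳ _ ⟨
      0# / fromℕ 1 * 1#         ≈⟨ *-congˡ fromℕ-1 ⟨
      0# / fromℕ 1 * fromℕ 1    ≈⟨ /-cancel (0<fromℕ 0) ⟩
      0#                        ∎

    u≮x : ∀ u → IsUpperBound (RationalPowers t) u → ¬ (u < x)
    u≮x u u-upper u<x =
      -- The exponent 0 is admissible, so its power 1 is at most `u`; only thereby does `u` have a
      -- logarithm.
      let 1≤u = u-upper 1# (ℚ.0ℚ , ≤-resp (sym 0/1≈0) refl (0≤ℓ log-x) , 0<1 , *-identityʳ 1#)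
          k , log-u = log-exists 1≤u
          r , 0≤r , k<r , r≤t = rational-between (0≤ℓ log-x) (log-mono-< log-u log-x u<x)
          y , log-y = log-surjective (≤.trans (0≤ℓ log-u) (proj₁ k<r))
      in <⇒≱ k<r (log-mono-≤ log-y log-u (u-upper y (r , r≤t , log⇒rationalPower {r} {y} 0≤r log-y)))

  log⇒2^ : ∀ {x t} → IsLog x t → 2^ t ≈ x
  log⇒2^ {x} {t} log-x = ≤.antisym (proj₂ sup x (proj₁ sup′)) (proj₂ sup′ (2^ t) (proj₁ sup))
    where
    sup′ = log⇒supremum log-x

    sup : IsSupremum (RationalPowers t) (2^ t)
    sup = the-satisfies 0# (IsSupremum (RationalPowers t)) (x , sup′)

  log-2^ : ∀ {t} → 0# ≤ t → IsLog (2^ t) t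
  log-2^ 0≤t = let x , log-x = log-surjective 0≤t in IsLog-resp (sym (log⇒2^ log-x)) refl log-x

  -- No supremum is exhibited for such `t`. Either the chosen value is one, and 1 bounds all the
  -- powers, or it is the default 0.
  2^-nonPos : ∀ {t} → t ≤ 0# → 2^ t ≤ 1#
  2^-nonPos {t} t≤0 =
    [ (λ sup → proj₂ sup 1# power≤1)
    , (λ 2^t≡0 → ≤-resp (reflexive (≡.sym 2^t≡0)) refl 0≤1)
    ]′ (the-cases 0# (IsSupremum (RationalPowers t)))
    where
    power≤1 : IsUpperBound (RationalPowers t) 1#
    power≤1 y (mkℚ (+ a) d _ , r≤t , 0<y , y^b≈2^a) =
      log-cancel-≤ (rationalPower⇒log {a} {d} 0<y y^b≈2^a) (log-two^ 0) (≤.trans r≤t t≤0)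
    power≤1 y (mkℚ -[1+ n ] d _ , _ , _ , y^b≈2^-a) = negativePower≤1 {n} {d} y^b≈2^-a

  -- log₂ picks some t with 2^ t ≈ x, a priori of any sign.
  log-log₂ : ∀ {x} → 1# < x → IsLog x (log₂ x)
  log-log₂ {x} 1<x = IsLog-resp 2^t≈x refl (log-2^ (proj₁ 0<t))
    where
    2^t≈x : 2^ log₂ x ≈ x
    2^t≈x = the-satisfies 0# (λ t → 2^ t ≈ x)
      (let t , log-x = log-exists (proj₁ 1<x) in t , log⇒2^ log-x)

    0<t : 0# < log₂ x
    0<t = ≰⇒> λ t≤0 → <⇒≱ 1<x (≤-resp 2^t≈x refl (2^-nonPos t≤0))

-- Absolute values and limits

module Limits (em : ExcludedMiddle 0ℓ) (R : RealField) where
  open Real em R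
  open IntegerCoefficients R
  open OrderedField em R
  open ≤-Reasoning

  x≤∣x∣ : ∀ x → x ≤ ∣ x ∣
  x≤∣x∣ x with total 0# x
  ... | inj₁ 0≤x = ≤.refl
  ... | inj₂ x≤0 = ≤.trans x≤0 (≤-by (≤⇒0≤ x≤0) (solve 1 (λ x → con (+ 0) :- x :=
        :- x :- con (+ 0)) refl x))

  -x≤∣x∣ : ∀ x → - x ≤ ∣ x ∣
  -x≤∣x∣ x with total 0# x
  ... | inj₁ 0≤x = ≤.trans (≤-by 0≤x (solve 1 (λ x → x := con (+ 0) :- :- x) refl x)) 0≤x
  ... | inj₂ x≤0 = ≤.refl

  ∣x∣< : ∀ {x y} → x < y → - x < y → ∣ x ∣ < y
  ∣x∣< {x} x<y -x<y with total 0# x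
  ... | inj₁ _ = x<y
  ... | inj₂ _ = -x<y

  0≤x⇒∣x∣≤x : ∀ {x} → 0# ≤ x → ∣ x ∣ ≤ x
  0≤x⇒∣x∣≤x {x} 0≤x with total 0# x
  ... | inj₁ _   = ≤.refl
  ... | inj₂ x≤0 = ≤-by (+-nonNeg 0≤x 0≤x) (solve 1 (λ x → x :+ x := x :- :- x) refl x)

  limit-of-eventually-constant : ∀ {s l c} N → (∀ n → s (N ℕ.+ n) ≈ c) → s ⟶ l → c ≈ l
  limit-of-eventually-constant {s} {l} {c} N s≈c s⟶l = ≤.antisym
    (≮⇒≥ λ l<c → let n , ∣∣<ε = within (<⇒0< l<c) in
      <⇒≱ ∣∣<ε (≤-resp (+-congʳ (s≈c n)) refl (x≤∣x∣ _)))
    (≮⇒≥ λ c<l → let n , ∣∣<ε = within (<⇒0< c<l) in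
      <⇒≱ ∣∣<ε (≤-resp (trans (-‿cong (+-congʳ (s≈c n))) (solve 2 (λ c l → :- (c :- l) :=
            l :- c) refl c l))
        refl (-x≤∣x∣ _)))
    where
    within : ∀ {ε} → 0# < ε → ∃ λ n → ∣ s (N ℕ.+ n) - l ∣ < ε
    within 0<ε = let n , close = s⟶l _ 0<ε in n , close (N ℕ.+ n) (ℕ.m≤n+m n N)

  sum-constant : ∀ n x → sum {n} (λ _ → x) ≈ fromℕ n * x
  sum-constant 0       x = sym (zeroˡ x)
  sum-constant (suc n) x = trans (+-congˡ (sum-constant n x))
    (solve 2 (λ n x → x :+ n :* x := (con (+ 1) :+ n) :* x) refl (fromℕ n) x)

-- Finite additivity, union bound and measurability from the countable axioms

module Probability (em : ExcludedMiddle 0ℓ) (R : RealField) (space : Real.ProbabilitySpace em R) where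
  open Real em R
  open ProbabilitySpace space
  open IntegerCoefficients R
  open OrderedField em R
  open Limits em R
  open ≤-Reasoning

  Event-∅ : Event ∅
  Event-∅ = Event-≐ ((λ ¬U → ¬U _) , λ ()) (Event-∁ Event-U)

  -- The empty set is the disjoint union of countably many copies of itself, so the multiples of its
  -- probability converge to that probability.
  ℙ-∅ : ℙ ∅ ≈ 0#
  ℙ-∅ = ≤.antisym (≮⇒≥ 0≮ℙ∅) (ℙ-nonNeg Event-∅)
    where
    ℙ⋃≈ℙ∅ : ℙ (⋃ ℕ λ _ → ∅) ≈ ℙ ∅
    ℙ⋃≈ℙ∅ = ℙ-≐ (Event-⋃ (λ _ → ∅) (λ _ → Event-∅)) ((λ ()) , λ ())

    0≮ℙ∅ : ¬ (0# < ℙ ∅)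
    0≮ℙ∅ 0<ℙ∅ =
      let N , close = ℙ-⋃ (λ _ → ∅) (λ _ → Event-∅) (λ _ _ _ ()) (ℙ ∅) 0<ℙ∅
          -- With p the probability of `∅`, also taken as ε, the (N+2)-nd partial sum differs from
          -- the limit by (N+1) p ≥ p.
          n = 2 ℕ.+ N
      in <⇒≱ (≤-<-trans (x≤∣x∣ _) (close n (ℕ.m≤n+m N 2))) (begin
           ℙ ∅
             ≤⟨ ≤-by (*-nonNeg (0≤fromℕ N) (proj₁ 0<ℙ∅)) (solve 2 (λ N p →
                                                           N :* p :=
                             (con (+ 1) :+ (con (+ 1) :+ N)) :* p :- p :- p) refl (fromℕ N) (ℙ ∅)) ⟩
           fromℕ n * ℙ ∅ - ℙ ∅                        ≈⟨ +-cong (sum-constant n (ℙ ∅)) (-‿cong ℙ⋃≈ℙ∅) ⟨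
           sum {n} (λ _ → ℙ ∅) - ℙ (⋃ ℕ λ _ → ∅)      ∎)

  private
    -- Padding with `∅` turns countable unions into binary ones; the partial sums of probabilities
    -- are constant from index 2 on.
    pair : Pred Ω 0ℓ → Pred Ω 0ℓ → ℕ → Pred Ω 0ℓ
    pair A B 0             = A
    pair A B 1             = B
    pair A B (suc (suc _)) = ∅

    Event-pair : ∀ {A B} → Event A → Event B → ∀ i → Event (pair A B i)
    Event-pair eA eB 0             = eA
    Event-pair eA eB 1             = eB
    Event-pair eA eB (suc (suc _)) = Event-∅

    ⋃-pair : ∀ {A B} → ⋃ ℕ (pair A B) ≐ A ∪ B
    ⋃-pair = (λ { (0 , a) → inj₁ a ; (1 , b) → inj₂ b })
           , (λ { (inj₁ a) → 0 , a ; (inj₂ b) → 1 , b })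

    pair-disjoint : ∀ {A B} → A ⊥ B → ∀ i j → i ≢ j → pair A B i ⊥ pair A B j
    pair-disjoint A⊥B 0 0             i≢j _       = ⊥-elim (i≢j ≡.refl)
    pair-disjoint A⊥B 0 1             _   (a , b) = A⊥B (a , b)
    pair-disjoint A⊥B 1 0             _   (b , a) = A⊥B (a , b)
    pair-disjoint A⊥B 1 1             i≢j _       = ⊥-elim (i≢j ≡.refl)
    pair-disjoint A⊥B (suc (suc _)) _ _   (() , _)
    pair-disjoint A⊥B 0 (suc (suc _)) _   (_ , ())
    pair-disjoint A⊥B 1 (suc (suc _)) _   (_ , ())

  Event-∪ : ∀ {A B} → Event A → Event B → Event (A ∪ B)
  Event-∪ {A} {B} eA eB = Event-≐ ⋃-pair (Event-⋃ (pair A B) (Event-pair eA eB))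

  Event-∩ : ∀ {A B} → Event A → Event B → Event (A ∩ B)
  Event-∩ {A} {B} eA eB = Event-≐ (to , λ { (a , b) (inj₁ ¬a) → ¬a a ; (a , b) (inj₂ ¬b) → ¬b b })
    (Event-∁ (Event-∪ (Event-∁ eA) (Event-∁ eB)))
    where
    to : ∀ {ω} → ¬ (¬ A ω ⊎ ¬ B ω) → A ω × B ω
    to ¬[¬a⊎¬b] = em⇒dne em (¬[¬a⊎¬b] ∘ inj₁) , em⇒dne em (¬[¬a⊎¬b] ∘ inj₂)

  ℙ-∪ : ∀ {A B} → Event A → Event B → A ⊥ B → ℙ (A ∪ B) ≈ ℙ A + ℙ B
  ℙ-∪ {A} {B} eA eB A⊥B = begin-equality
    ℙ (A ∪ B)             ≈⟨ ℙ-≐ (Event-⋃ (pair A B) (Event-pair eA eB)) ⋃-pair ⟨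
    ℙ (⋃ ℕ (pair A B))    ≈⟨ limit-of-eventually-constant 2 partial-sum
                              (ℙ-⋃ (pair A B) (Event-pair eA eB) (pair-disjoint A⊥B)) ⟨
    ℙ A + ℙ B             ∎
    where
    partial-sum : ∀ n → ℙ A + (ℙ B + sum {n} (λ _ → ℙ ∅)) ≈ ℙ A + ℙ B
    partial-sum n = +-congˡ (trans (+-congˡ (trans (sum-constant n (ℙ ∅))
      (trans (*-congˡ ℙ-∅) (zeroʳ _)))) (+-identityʳ _))

  ℙ-∁ : ∀ {A} → Event A → ℙ (∁ A) ≈ 1# - ℙ A
  ℙ-∁ {A} eA = begin-equality
    ℙ (∁ A)               ≈⟨ solve 2 (λ a b → b := (a :+ b) :- a) refl (ℙ A) (ℙ (∁ A)) ⟩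
    ℙ A + ℙ (∁ A) - ℙ A   ≈⟨ +-congʳ (ℙ-∪ eA (Event-∁ eA) λ (a , ¬a) → ¬a a) ⟨
    ℙ (A ∪ ∁ A) - ℙ A     ≈⟨ +-congʳ (ℙ-≐ (Event-∪ eA (Event-∁ eA)) (_ , λ {ω} _ → decide ω)) ⟩
    ℙ U - ℙ A             ≈⟨ +-congʳ ℙ-U ⟩
    1# - ℙ A              ∎
    where
    decide : ∀ ω → A ω ⊎ ¬ A ω
    decide ω with em {A ω}
    ... | yes a = inj₁ a
    ... | no ¬a = inj₂ ¬a

  ℙ-∪-≤ : ∀ {A B} → Event A → Event B → ℙ (A ∪ B) ≤ ℙ A + ℙ B
  ℙ-∪-≤ {A} {B} eA eB = begin
    ℙ (A ∪ B)                           ≈⟨ ℙ-≐ (Event-∪ eA eB∖A) (to , from) ⟨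
    ℙ (A ∪ (B ∩ ∁ A))                   ≈⟨ ℙ-∪ eA eB∖A (λ (a , _ , ¬a) → ¬a a) ⟩
    ℙ A + ℙ (B ∩ ∁ A)                   ≤⟨ +-monoʳ-≤ (ℙ A) (≤-by (ℙ-nonNeg eB∩A) ℙ[B∩A]) ⟩
    ℙ A + ℙ B                           ∎
    where
    eB∖A = Event-∩ eB (Event-∁ eA)
    eB∩A = Event-∩ eB eA

    to : ∀ {ω} → A ω ⊎ B ω × ¬ A ω → A ω ⊎ B ω
    to (inj₁ a)       = inj₁ a
    to (inj₂ (b , _)) = inj₂ b

    from : ∀ {ω} → A ω ⊎ B ω → A ω ⊎ B ω × ¬ A ω
    from (inj₁ a) = inj₁ a
    from {ω} (inj₂ b) with em {A ω}
    ... | yes a = inj₁ a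
    ... | no ¬a = inj₂ (b , ¬a)

    split : ∀ {ω} → B ω → (B ω × ¬ A ω) ⊎ (B ω × A ω)
    split {ω} b with em {A ω}
    ... | yes a = inj₂ (b , a)
    ... | no ¬a = inj₁ (b , ¬a)

    ℙB : ℙ (B ∩ ∁ A) + ℙ (B ∩ A) ≈ ℙ B
    ℙB = trans (sym (ℙ-∪ eB∖A eB∩A λ ((_ , ¬a) , (_ , a)) → ¬a a))
      (ℙ-≐ (Event-∪ eB∖A eB∩A) ([ proj₁ , proj₁ ]′ , split))

    ℙ[B∩A] : ℙ (B ∩ A) ≈ ℙ B - ℙ (B ∩ ∁ A)
    ℙ[B∩A] = trans (solve 2 (λ x y → y := (x :+ y) :- x) refl (ℙ (B ∩ ∁ A)) (ℙ (B ∩ A))) (+-congʳ ℙB)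

  ∃-suc : ∀ {m} {A : Fin (suc m) → Pred Ω 0ℓ} →
          (A Fin.zero ∪ λ ω → ∃ λ j → A (Fin.suc j) ω) ≐ (λ ω → ∃ λ j → A j ω)
  ∃-suc = (λ { (inj₁ a) → Fin.zero , a ; (inj₂ (j , a)) → Fin.suc j , a })
        , (λ { (Fin.zero , a) → inj₁ a ; (Fin.suc j , a) → inj₂ (j , a) })

  Event-∃ : ∀ {m} {A : Fin m → Pred Ω 0ℓ} → (∀ j → Event (A j)) → Event (λ ω → ∃ λ j → A j ω)
  Event-∃ {0}         eA = Event-≐ ((λ ()) , λ ()) Event-∅
  Event-∃ {suc m} {A} eA = Event-≐ (∃-suc {A = A}) (Event-∪ (eA Fin.zero) (Event-∃ (eA ∘ Fin.suc)))

  union-bound : ∀ {m} {A : Fin m → Pred Ω 0ℓ} c → (∀ j → Event (A j)) → (∀ j → ℙ (A j) ≤ c) →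
                ℙ (λ ω → ∃ λ j → A j ω) ≤ fromℕ m * c
  union-bound {0} c eA _ = ≤.reflexive (trans
    (ℙ-≐ (Event-∃ eA) ((λ ()) , λ ())) (trans ℙ-∅ (sym (zeroˡ c))))
  union-bound {suc m} {A} c eA A≤c = begin
    ℙ (λ ω → ∃ λ j → A j ω)
      ≈⟨ ℙ-≐ (Event-∪ (eA Fin.zero) (Event-∃ (eA ∘ Fin.suc))) (∃-suc {A = A}) ⟨
    ℙ (A Fin.zero ∪ λ ω → ∃ λ j → A (Fin.suc j) ω)
      ≤⟨ ℙ-∪-≤ (eA Fin.zero) (Event-∃ (eA ∘ Fin.suc)) ⟩
    ℙ (A Fin.zero) + ℙ (λ ω → ∃ λ j → A (Fin.suc j) ω)
      ≤⟨ +-mono-≤ (A≤c Fin.zero) (union-bound c (eA ∘ Fin.suc) (A≤c ∘ Fin.suc)) ⟩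
    c + fromℕ m * c
      ≈⟨ solve 2 (λ m c → c :+ m :* c := (con (+ 1) :+ m) :* c) refl (fromℕ m) c ⟩
    fromℕ (suc m) * c                  ∎

  ¬∃¬≐∀ : ∀ {m} (A : Fin m → Pred Ω 0ℓ) → ∁ (λ ω → ∃ λ j → ¬ A j ω) ≐ (λ ω → ∀ j → A j ω)
  ¬∃¬≐∀ A = (λ ¬∃¬ j → em⇒dne em λ ¬a → ¬∃¬ (j , ¬a)) , λ a (j , ¬a) → ¬a (a j)

  Event-∀ : ∀ {m} {A : Fin m → Pred Ω 0ℓ} → (∀ j → Event (A j)) → Event (λ ω → ∀ j → A j ω)
  Event-∀ {A = A} eA = Event-≐ (¬∃¬≐∀ A) (Event-∁ (Event-∃ (Event-∁ ∘ eA)))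

  ℙ-∀-≥ : ∀ {m} {A : Fin m → Pred Ω 0ℓ} c → (∀ j → Event (A j)) → (∀ j → ℙ (∁ (A j)) ≤ c) →
          1# - fromℕ m * c ≤ ℙ (λ ω → ∀ j → A j ω)
  ℙ-∀-≥ {m} {A} c eA ∁A≤c = begin
    1# - fromℕ m * c
      ≤⟨ +-monoʳ-≤ 1# (neg-anti-≤ (union-bound c (Event-∁ ∘ eA) ∁A≤c)) ⟩
    1# - ℙ (λ ω → ∃ λ j → ¬ A j ω)              ≈⟨ ℙ-∁ (Event-∃ (Event-∁ ∘ eA)) ⟨
    ℙ (∁ λ ω → ∃ λ j → ¬ A j ω)                 ≈⟨ ℙ-≐ (Event-∁ (Event-∃ (Event-∁ ∘ eA))) (¬∃¬≐∀ A) ⟩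
    ℙ (λ ω → ∀ j → A j ω)                       ∎

  -- Measurability is given for the events X ≤ t only. The strict event is the countable union of
  -- the events X ≤ t - 1/(k+1).
  Event-< : ∀ {X : Ω → ℝ} → (∀ t → Event (λ ω → X ω ≤ t)) → ∀ t → Event (λ ω → X ω < t)
  Event-< {X} measurable t = Event-≐ (to , from)
    (Event-⋃ (λ k ω → X ω ≤ t - 1# / fromℕ (suc k)) (λ k → measurable (t - 1# / fromℕ (suc k))))
    where
    to : ∀ {ω} → (∃ λ k → X ω ≤ t - 1# / fromℕ (suc k)) → X ω < t
    to (k , X≤) = ≤-<-trans X≤ (<-by (/-pos 0<1 (0<fromℕ k))
      (solve 2 (λ t x → x := t :- (t :- x)) refl t (1# / fromℕ (suc k))))

    from : ∀ {ω} → X ω < t → ∃ λ k → X ω ≤ t - 1# / fromℕ (suc k)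
    from {ω} X<t = let k , 1<k[t-X] = archimedean-* 1# (<⇒0< X<t) in k , ≤-by
      (≤⇒0≤ (*-cancelˡ-≤ (0<fromℕ k) (begin
        fromℕ (suc k) * (1# / fromℕ (suc k))   ≈⟨ trans (*-comm _ _) (/-cancel (0<fromℕ k)) ⟩
        1#                                     ≤⟨ proj₁ 1<k[t-X] ⟩
        fromℕ k * (t - X ω)                    ≤⟨ ≤-by (≤⇒0≤ (proj₁ X<t)) (solve 3 (λ k t x →
                                                   t :- x :=
                            (con (+ 1) :+ k) :* (t :- x) :- k :* (t :- x)) refl (fromℕ k) t (X ω)) ⟩
        fromℕ (suc k) * (t - X ω)              ∎)))
      (solve 3 (λ t x y → t :- x :- y := t :- y :- x) refl t (X ω) (1# / fromℕ (suc k)))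

-- Estimates of (1 - d)^n

module Tails (em : ExcludedMiddle 0ℓ) (R : RealField) where
  open Real em R
  open IntegerCoefficients R
  open OrderedField em R
  open Exp commutativeSemiring using (^-distrib-*)
  open ≤-Reasoning

  -- (1 - d)^n (1 + d)^n ≤ 1 turns Bernoulli's lower bound for (1 + d)^n into
  -- an upper bound for (1 - d)^n.
  [1-d]^n*nd≤1 : ∀ {d} n → 0# ≤ d → d ≤ 1# → (1# - d) ^ n * (fromℕ n * d) ≤ 1#
  [1-d]^n*nd≤1 {d} n 0≤d d≤1 = begin
    (1# - d) ^ n * (fromℕ n * d)         ≤⟨ *-monoˡ-≤ 0≤[1-d]^n (begin
      fromℕ n * d
        ≤⟨ ≤-by 0≤1 (solve 1 (λ x → con (+ 1) := con (+ 1) :+ x :- x) refl (fromℕ n * d)) ⟩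
      1# + fromℕ n * d     ≤⟨ bernoulli n (+-nonNeg 0≤1 0≤d) ⟩
      (1# + d) ^ n         ∎) ⟩
    (1# - d) ^ n * (1# + d) ^ n          ≈⟨ ^-distrib-* (1# - d) (1# + d) n ⟨
    ((1# - d) * (1# + d)) ^ n            ≤⟨ ^-monoˡ-≤ n (*-nonNeg (≤⇒0≤ d≤1) (+-nonNeg 0≤1 0≤d))
                                              (≤-by (*-nonNeg 0≤d 0≤d) (solve 1 (λ d →
                                                d :* d :=
                                       con (+ 1) :- (con (+ 1) :- d) :* (con (+ 1) :+ d)) refl d)) ⟩
    1# ^ n                               ≈⟨ 1^n≈1 n ⟩
    1#                                   ∎
    where
    0≤[1-d]^n : 0# ≤ (1# - d) ^ n
    0≤[1-d]^n = ^-nonNeg n (≤⇒0≤ d≤1)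

  1-[1-d]^n≤nd : ∀ {d} n → d ≤ 1# → 1# - (1# - d) ^ n ≤ fromℕ n * d
  1-[1-d]^n≤nd {d} n d≤1 = ≤-by (≤⇒0≤ (bernoulli n (≤⇒0≤ d≤1)))
    (solve 3 (λ n d p → p :- (con (+ 1) :+ n :* (:- d)) := n :* d :- (con (+ 1) :- p)) refl
      (fromℕ n) d ((1# - d) ^ n))

-- Ceilings of positive reals

module Ceiling (em : ExcludedMiddle 0ℓ) (R : RealField) where
  open Real em R
  open OrderedField em R
  open RingProperties ring using (-0#≈0#)

  IsCeiling : ℝ → ℤ → Set
  IsCeiling x k = x ≤ fromℤ k × (∀ j → x ≤ fromℤ j → k ℤ.≤ j)

  abstract
    bracket : ∀ {x} → 0# < x → ∃ λ k → fromℕ k < x × x ≤ fromℕ (suc k)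
    bracket {x} 0<x = let n , x<n = archimedean x in search n (proj₁ x<n)
      where
      search : ∀ n → x ≤ fromℕ n → ∃ λ k → fromℕ k < x × x ≤ fromℕ (suc k)
      search 0       x≤0 = ⊥-elim (<⇒≱ 0<x x≤0)
      search (suc n) x≤1+n = [ search n , (λ n<x → n , n<x , x≤1+n) ]′ (x ≤? fromℕ n)

  bracket⇒ceiling : ∀ {x k} → fromℕ k < x → x ≤ fromℕ (suc k) → IsCeiling x (+ suc k)
  bracket⇒ceiling {x} {k} k<x x≤1+k = x≤1+k , minimal
    where
    minimal : ∀ j → x ≤ fromℤ j → + suc k ℤ.≤ j
    minimal (+ j)    x≤j = ℤ.+≤+ (fromℕ-cancel-< {k} {j} (<-≤-trans k<x x≤j))
    minimal -[1+ j ] x≤j = ⊥-elim (<⇒≱ (≤-<-trans (0≤fromℕ k) (<-≤-trans k<x x≤j)) (-fromℕ≤0 (suc j)))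
      where
      -fromℕ≤0 : ∀ n → - fromℕ n ≤ 0#
      -fromℕ≤0 n = ≤-resp refl -0#≈0# (neg-anti-≤ (0≤fromℕ n))

  -- `⌈_⌉` is a choice among integers, so its value comes from uniqueness of the least integer above
  -- `x`. The bound by `k` from below serves the growth estimate, the one from above the coding.
  ⌈⌉-positive : ∀ {x} → 0# < x → ∃ λ k → ⌈ x ⌉ ≡ + suc k × fromℕ k < x × x ≤ fromℕ (suc k)
  ⌈⌉-positive {x} 0<x =
    let k , k<x , x≤1+k = bracket 0<x
        x≤1+k′ , 1+k-least = bracket⇒ceiling {x} {k} k<x x≤1+k
        x≤⌈x⌉ , ⌈x⌉-least = the-satisfies (+ 0) (IsCeiling x) (+ suc k , x≤1+k′ , 1+k-least)
    in k , ℤ.≤-antisym (⌈x⌉-least (+ suc k) x≤1+k′) (1+k-least ⌈ x ⌉ x≤⌈x⌉) , k<x , x≤1+k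

-- Encoding an interval by binary words

module Coding (em : ExcludedMiddle 0ℓ) (R : RealField) where
  open Real em R
  open IntegerCoefficients R
  open OrderedField em R
  open Limits em R
  open ≤-Reasoning

  toNat : ∀ {d} → Vec Bool d → ℕ
  toNat {0}     []           = 0
  toNat {suc d} (false ∷ bs) = toNat bs
  toNat {suc d} (true ∷ bs)  = 2 ℕ.^ d ℕ.+ toNat bs

  toNat-surjective : ∀ d k → k ℕ.< 2 ℕ.^ d → ∃ λ (c : Vec Bool d) → toNat c ≡ k
  toNat-surjective 0       0 _ = [] , ≡.refl
  toNat-surjective 0       (suc _) (s≤s ())
  toNat-surjective (suc d) k k<2^1+d with k ℕ.<? 2 ℕ.^ d
  ... | yes k<2^d = let c , c≡k = toNat-surjective d k k<2^d in false ∷ c , c≡k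
  ... | no k≮2^d  =
    let 2^d≤k = ℕ.≮⇒≥ k≮2^d
        c , c≡k-2^d = toNat-surjective d (k ℕ.∸ 2 ℕ.^ d)
          (ℕ.+-cancelˡ-< (2 ℕ.^ d) _ _ (≡.subst₂ ℕ._<_ (≡.sym (ℕ.m+[n∸m]≡n 2^d≤k))
            (≡.cong (2 ℕ.^ d ℕ.+_) (ℕ.+-identityʳ _)) k<2^1+d))
    in true ∷ c , ≡.trans (≡.cong (2 ℕ.^ d ℕ.+_) c≡k-2^d) (ℕ.m+[n∸m]≡n 2^d≤k)

  nonNeg-integer : ∀ {x} k → x ≈ fromℤ k → 0# ≤ x → ∃ λ n → fromℕ n ≈ x
  nonNeg-integer (+ n)    x≈k _ = n , sym x≈k
  nonNeg-integer -[1+ n ] x≈k 0≤x = ⊥-elim (<⇒≱ (0<fromℕ n) (≤-by 0≤x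
    (trans x≈k (solve 1 (λ n → :- n := con (+ 0) :- n) refl (fromℕ (suc n))))))

  -- The codes stand for the integers a + 1, …, a + 2 ^ d; all integers in the
  -- interval are among them, and rounding down (up, below a + 1) errs by less than 1.
  representable : ∀ {B Δ} d → 0# ≤ B - Δ → Δ + Δ ≤ fromℕ (2 ℕ.^ d) →
                  RepresentableAsOffsets B (OpenInterval (B - Δ) (B + Δ)) d
  representable {B} {Δ} d 0≤B-Δ 2Δ≤2^d = offset , λ x (lo , hi) → encode lo hi (floor (0≤x lo))
    where
    ⌊B-Δ⌋ : ∃ λ a → fromℕ a ≤ B - Δ × B - Δ < fromℕ (suc a)
    ⌊B-Δ⌋ = floor 0≤B-Δ

    a = proj₁ ⌊B-Δ⌋

    offset : Vec Bool d → ℝ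
    -- `B` is rarely an integer; subtracting it here makes base plus offset an integer.
    offset c = fromℕ (suc a ℕ.+ toNat c) - B

    0≤x : ∀ {x} → B - Δ < x → 0# ≤ x
    0≤x lo = ≤.trans 0≤B-Δ (proj₁ lo)

    value : ∀ k → k ℕ.< 2 ℕ.^ d → ∃ λ c → B + offset c ≈ fromℕ (suc a ℕ.+ k)
    value k k<2^d = let c , c≡k = toNat-surjective d k k<2^d in c , trans
      (solve 2 (λ b v → b :+ (v :- b) :=
            v) refl B _) (reflexive (≡.cong (λ k → fromℕ (suc a ℕ.+ k)) c≡k))

    Encoding : ℝ → Set
    Encoding x = ∃ λ c → (IsInteger x → B + offset c ≈ x) × ∣ (B + offset c) - x ∣ < 1#

    within-1 : ∀ {v w x} → v ≈ w → w < x + 1# → x < w + 1# → ∣ v - x ∣ < 1#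
    within-1 {v} {w} {x} v≈w w<x+1 x<w+1 = ∣x∣<
      (<-resp (+-congʳ (sym v≈w)) refl (<-by (<⇒0< w<x+1) (solve 2 (λ w x →
        x :+ con (+ 1) :- w := con (+ 1) :- (w :- x)) refl w x)))
      (<-resp (-‿cong (+-congʳ (sym v≈w))) refl (<-by (<⇒0< x<w+1) (solve 2 (λ w x →
        w :+ con (+ 1) :- x := con (+ 1) :- :- (w :- x)) refl w x)))

    -- Such an `x` lies strictly between the consecutive integers a and a + 1, so the exactness
    -- clause is vacuous and the first code is close enough.
    round-up : ∀ {x} → B - Δ < x → x < fromℕ (suc a) → Encoding x
    round-up {x} lo x<1+a =
      let c , c≈1+a = value 0 (ℕ.m^n>0 2 d)
      in c , (λ (k , x≈k) →
                let n , n≈x = nonNeg-integer k x≈k (0≤x lo)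
                    a<n = fromℕ-cancel-< {a} {n} (<-resp refl (sym n≈x) a<x)
                    n<1+a = fromℕ-cancel-< {n} {suc a} (<-resp (sym n≈x) refl x<1+a)
                in ⊥-elim (ℕ.<⇒≱ n<1+a a<n))
           , within-1 (trans c≈1+a (reflexive (≡.cong fromℕ (ℕ.+-identityʳ (suc a)))))
               (<-resp (+-comm _ _) refl (+-mono-<-≤ a<x ≤.refl)) (<-trans x<1+a (x<x+1 _))
      where
      a<x : fromℕ a < x
      a<x = ≤-<-trans (proj₁ (proj₂ ⌊B-Δ⌋)) lo

    round-down : ∀ {x q} → x < B + Δ → fromℕ (suc a) ≤ x → fromℕ q ≤ x → x < fromℕ (suc q) → Encoding x
    round-down {x} {q} hi 1+a≤x q≤x x<1+q =
      let c , c≈ = value (q ℕ.∸ suc a) k<2^d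
          c≈q = trans c≈ (reflexive (≡.cong fromℕ (ℕ.m+[n∸m]≡n 1+a≤q)))
      in c , (λ (k , x≈k) →
                let n , n≈x = nonNeg-integer k x≈k (≤.trans (0≤fromℕ q) q≤x)
                    q≤n = fromℕ-cancel-≤ {q} {n} (≤-resp refl (sym n≈x) q≤x)
                    n<1+q = fromℕ-cancel-< {n} {suc q} (<-resp (sym n≈x) refl x<1+q)
                in trans c≈q (trans (reflexive (≡.cong fromℕ (ℕ.≤-antisym q≤n (ℕ.s≤s⁻¹ n<1+q)))) n≈x))
           , within-1 c≈q (≤-<-trans q≤x (x<x+1 x)) (<-resp refl (+-comm _ _) x<1+q)
      where
      1+a≤q : suc a ℕ.≤ q
      1+a≤q = ℕ.s≤s⁻¹ (fromℕ-cancel-< {suc a} {suc q} (≤-<-trans 1+a≤x x<1+q))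

      q<1+a+2^d : q ℕ.< suc a ℕ.+ 2 ℕ.^ d
      q<1+a+2^d = fromℕ-cancel-< {q} {suc a ℕ.+ 2 ℕ.^ d} (begin-strict
        fromℕ q                              ≤⟨ q≤x ⟩
        x                                    <⟨ hi ⟩
        B + Δ
          ≈⟨ solve 2 (λ b δ → b :+ δ := (b :- δ) :+ (δ :+ δ)) refl B Δ ⟩
        (B - Δ) + (Δ + Δ)                    ≤⟨ +-mono-≤ (proj₁ (proj₂ (proj₂ ⌊B-Δ⌋))) 2Δ≤2^d ⟩
        fromℕ (suc a) + fromℕ (2 ℕ.^ d)      ≈⟨ fromℕ-+ (suc a) (2 ℕ.^ d) ⟨
        fromℕ (suc a ℕ.+ 2 ℕ.^ d)            ∎)

      k<2^d : q ℕ.∸ suc a ℕ.< 2 ℕ.^ d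
      k<2^d = ℕ.+-cancelˡ-< (suc a) _ _ (≡.subst (ℕ._< suc a ℕ.+ 2 ℕ.^ d) (≡.sym (ℕ.m+[n∸m]≡n 1+a≤q)) q<1+a+2^d)

    encode : ∀ {x} → B - Δ < x → x < B + Δ → (∃ λ q → fromℕ q ≤ x × x < fromℕ (suc q)) → Encoding x
    encode {x} lo hi (q , q≤x , x<1+q) =
      [ (λ 1+a≤x → round-down {x} {q} hi 1+a≤x q≤x x<1+q) , round-up lo ]′ (fromℕ (suc a) ≤? x)

-- Number of bits and its growth

module RegisterBounds (em : ExcludedMiddle 0ℓ) (R : RealField)
  (β : RealField.ℝ R) (0<β : RealField._<_ R (RealField.0# R) β)
  (β<1 : RealField._<_ R β (RealField.1# R)) where
  open Real em R
  open IntegerCoefficients R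
  open OrderedField em R
  open BinaryLogarithm em R
  open IsLog
  open Exponential em R
  open Limits em R
  open Tails em R
  open Ceiling em R
  open Coding em R
  open ≤-Reasoning

  L Δ loglogL : ℕ → ℝ
  L m       = (two * fromℕ m) / β
  Δ m       = log₂ (L m)
  loglogL m = log₂ (Δ m)

  bits : ℕ → ℤ
  bits m = ⌈ loglogL m ⌉ ℤ.+ + 1

  Lβ≈2m : ∀ m → L m * β ≈ two * fromℕ m
  Lβ≈2m m = /-cancel 0<β

  1≤fromℕ : ∀ {m} → 1 ℕ.≤ m → 1# ≤ fromℕ m
  1≤fromℕ {m} 1≤m = ≤-resp fromℕ-1 refl (fromℕ-mono-≤ {1} {m} 1≤m)

  -- Strictness comes from β < 1. It gives Δ > 1, so both nested logarithms have arguments above 1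
  -- and the ceiling is taken of a positive number.
  two<L : ∀ {m} → 1 ℕ.≤ m → two < L m
  two<L {m} 1≤m = *-cancelˡ-< 0<β (begin-strict
    β * two           ≈⟨ *-comm β two ⟩
    two * β           <⟨ *-monoˡ-< (0<fromℕ 1) β<1 ⟩
    two * 1#          ≤⟨ *-monoˡ-≤ (0≤fromℕ 2) (1≤fromℕ 1≤m) ⟩
    two * fromℕ m     ≈⟨ trans (*-comm _ _) (Lβ≈2m m) ⟨
    β * L m           ∎)

  1<L : ∀ {m} → 1 ℕ.≤ m → 1# < L m
  1<L 1≤m = <-trans 1<two (two<L 1≤m)

  log-L : ∀ {m} → 1 ℕ.≤ m → IsLog (L m) (Δ m)
  log-L 1≤m = log-log₂ (1<L 1≤m)

  1<Δ : ∀ {m} → 1 ℕ.≤ m → 1# < Δ m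
  1<Δ 1≤m = <-resp fromℕ-1 refl
    (log-mono-< (log-two^ 1) (log-L 1≤m) (<-resp (sym (*-identityʳ two)) refl (two<L 1≤m)))

  log-Δ : ∀ {m} → 1 ℕ.≤ m → IsLog (Δ m) (loglogL m)
  log-Δ 1≤m = log-log₂ (1<Δ 1≤m)

  bits-value : ∀ {m} → 1 ℕ.≤ m →
    ∃ λ k → bits m ≡ + suc (suc k) × fromℕ k < loglogL m × loglogL m ≤ fromℕ (suc k)
  bits-value 1≤m =
    let k , ⌈⌉≡1+k , k< , ≤1+k = ⌈⌉-positive (log-pos (1<Δ 1≤m) (log-Δ 1≤m))
    in k , ≡.trans (≡.cong (ℤ._+ + 1) ⌈⌉≡1+k) (≡.cong +_ (ℕ.+-comm (suc k) 1)) , k< , ≤1+k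

  fromℕ-2^ : ∀ k → fromℕ (2 ℕ.^ k) ≈ two ^ k
  fromℕ-2^ 0       = fromℕ-1
  fromℕ-2^ (suc k) = trans (fromℕ-* 2 (2 ℕ.^ k)) (*-congˡ (fromℕ-2^ k))

  -- With `suc k` the ceiling of log₂ Δ, Δ is at most 2^(k+1). The interval extends Δ to each side
  -- of `B`, and the additional bit pays for this factor of two.
  offsets : ∀ {m B} → 1 ℕ.≤ m → 0# ≤ B - Δ m →
    ∃ λ d → (+ d ℤ.≤ bits m) × RepresentableAsOffsets B (OpenInterval (B - Δ m) (B + Δ m)) d
  offsets {m} {B} 1≤m 0≤B-Δ =
    let k , bits≡2+k , _ , loglogL≤1+k = bits-value 1≤m
        Δ≤2^1+k = log-cancel-≤ (log-Δ 1≤m) (log-two^ (suc k)) loglogL≤1+k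
    in suc (suc k) , ℤ.≤-reflexive (≡.sym bits≡2+k) ,
       representable {B} {Δ m} (suc (suc k)) 0≤B-Δ (begin
         Δ m + Δ m                          ≤⟨ +-mono-≤ Δ≤2^1+k Δ≤2^1+k ⟩
         two ^ suc k + two ^ suc k
           ≈⟨ solve 1 (λ x → x :+ x := (con (+ 1) :+ con (+ 1)) :* x) refl (two ^ suc k) ⟩
         (1# + 1#) * two ^ suc k            ≈⟨ *-congʳ two≈1+1 ⟨
         two ^ suc (suc k)                  ≈⟨ fromℕ-2^ (suc (suc k)) ⟨
         fromℕ (2 ℕ.^ suc (suc k))          ∎)

  -- For m ≥ 2/β, 2m/β ≤ m², so log₂ log₂ (2m/β) ≤ 1 + log₂ log₂ m; and
  -- log₂ log₂ m ≥ 1 from m = 4 on.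
  loglog-bound : ∀ {m} → 4 ℕ.≤ m → two ≤ fromℕ m * β →
                 1# ≤ log₂ (log₂ (fromℕ m)) × loglogL m ≤ 1# + log₂ (log₂ (fromℕ m))
  loglog-bound {m} 4≤m 2≤mβ = 1≤g , loglogL≤1+g
    where
    1≤m : 1 ℕ.≤ m
    1≤m = ℕ.≤-trans (s≤s z≤n) 4≤m

    M = fromℕ m

    2^2≤M : two ^ 2 ≤ M
    2^2≤M = ≤-resp (fromℕ-2^ 2) refl (fromℕ-mono-≤ {4} {m} 4≤m)

    1<2^2 : 1# < two ^ 2
    1<2^2 = 1<x^1+n 1 1<two

    log-M : IsLog M (log₂ M)
    log-M = log-log₂ (<-≤-trans 1<2^2 2^2≤M)

    2≤log : two ≤ log₂ M
    2≤log = log-mono-≤ (log-two^ 2) log-M 2^2≤M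

    log-log-M : IsLog (log₂ M) (log₂ (log₂ M))
    log-log-M = log-log₂ (<-≤-trans 1<two 2≤log)

    1≤g : 1# ≤ log₂ (log₂ M)
    1≤g = ≤-resp fromℕ-1 refl (log-mono-≤ (log-two^ 1) log-log-M (≤-resp (sym (*-identityʳ two)) refl 2≤log))

    L≤M² : L m ≤ M * M
    L≤M² = *-cancelˡ-≤ 0<β (begin
      β * L m       ≈⟨ trans (*-comm _ _) (Lβ≈2m m) ⟩
      two * M       ≈⟨ *-comm two M ⟩
      M * two       ≤⟨ *-monoˡ-≤ (0≤fromℕ m) 2≤mβ ⟩
      M * (M * β)   ≈⟨ solve 2 (λ m β → m :* (m :* β) := β :* (m :* m)) refl M β ⟩
      β * (M * M)   ∎)

    Δ≤2log : Δ m ≤ two ^ 1 * log₂ M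
    Δ≤2log = ≤-resp refl
      (trans (solve 1 (λ w → w :+ w := (con (+ 1) :+ con (+ 1)) :* w) refl (log₂ M))
             (*-congʳ (trans (sym two≈1+1) (sym (*-identityʳ two)))))
      (log-mono-≤ (log-L 1≤m) (log-* log-M log-M) L≤M²)

    loglogL≤1+g : loglogL m ≤ 1# + log₂ (log₂ M)
    loglogL≤1+g = ≤-resp refl (+-congʳ fromℕ-1)
      (log-mono-≤ (log-Δ 1≤m) (log-* (log-two^ 1) log-log-M) Δ≤2log)

  bits-bound : (λ m → fromℤ (bits m)) =O (λ m → log₂ (log₂ (fromℕ m)))
  -- With g = log₂ log₂ m, the number of bits is k + 2 ≤ 3 + g ≤ 4 g as soon as g ≥ 1. The summand 4
  -- secures g ≥ 1, and `N` secures m ≥ 2/β.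
  bits-bound = 1# + 1# + (1# + 1#) , 4 ℕ.+ N , bound
    where
    N = proj₁ (archimedean-* two 0<β)

    two<Nβ : two < fromℕ N * β
    two<Nβ = proj₂ (archimedean-* two 0<β)

    bound : ∀ m → 4 ℕ.+ N ℕ.≤ m →
            ∣ fromℤ (bits m) ∣ ≤ (1# + 1# + (1# + 1#)) * ∣ log₂ (log₂ (fromℕ m)) ∣
    bound m 4+N≤m =
      let 4≤m = ℕ.≤-trans (ℕ.m≤m+n 4 N) 4+N≤m
          N≤m = ℕ.≤-trans (ℕ.m≤n+m N 4) 4+N≤m
          2≤mβ = ≤.trans (proj₁ two<Nβ) (≤-resp (*-comm _ _) (*-comm _ _)
                   (*-monoˡ-≤ (proj₁ 0<β) (fromℕ-mono-≤ {N} {m} N≤m)))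
          1≤g , loglogL≤1+g = loglog-bound 4≤m 2≤mβ
          k , bits≡2+k , k<loglogL , _ = bits-value (ℕ.≤-trans (s≤s z≤n) 4≤m)
      in combine k bits≡2+k 1≤g (≤.trans (proj₁ k<loglogL) loglogL≤1+g)
      where
      g = log₂ (log₂ (fromℕ m))

      combine : ∀ k → bits m ≡ + suc (suc k) → 1# ≤ g → fromℕ k ≤ 1# + g →
                ∣ fromℤ (bits m) ∣ ≤ (1# + 1# + (1# + 1#)) * ∣ g ∣
      combine k bits≡2+k 1≤g k≤1+g = begin
        ∣ fromℤ (bits m) ∣                  ≡⟨ ≡.cong (λ b → ∣ fromℤ b ∣) bits≡2+k ⟩
        ∣ fromℕ (suc (suc k)) ∣             ≤⟨ 0≤x⇒∣x∣≤x (0≤fromℕ (suc (suc k))) ⟩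
        1# + (1# + fromℕ k)                 ≤⟨ ≤-by (+-nonNeg (≤⇒0≤ k≤1+g)
                                             (+-nonNeg (≤⇒0≤ 1≤g) (+-nonNeg (≤⇒0≤ 1≤g) (≤⇒0≤ 1≤g))))
                                                (solve 2 (λ k g →
              (con (+ 1) :+ g :- k) :+ ((g :- con (+ 1)) :+ ((g :- con (+ 1)) :+ (g :- con (+ 1)))) :=
              (con (+ 1) :+ con (+ 1) :+ (con (+ 1) :+ con (+ 1))) :* g :- (con (+ 1) :+ (con (+ 1) :+ k)))
                                                  refl (fromℕ k) g) ⟩
        (1# + 1# + (1# + 1#)) * g
          ≤⟨ *-monoˡ-≤ (+-nonNeg (+-nonNeg 0≤1 0≤1) (+-nonNeg 0≤1 0≤1)) (x≤∣x∣ g) ⟩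
        (1# + 1# + (1# + 1#)) * ∣ g ∣       ∎

  -- Tail bounds at B - Δ and B + Δ, and the union bound

  module _ {m n : ℕ} (1≤m : 1 ℕ.≤ m) (2m²/β<n : (two * fromℕ m ^ 2) / β < fromℕ n) where

    u B : ℝ
    u = fromℕ n / fromℕ m
    B = log₂ u

    0<m : 0# < fromℕ m
    0<m = <-≤-trans 0<1 (1≤fromℕ 1≤m)

    um≈n : u * fromℕ m ≈ fromℕ n
    um≈n = /-cancel 0<m

    -- The assumption on `n` divided by m, as 2m²/β is m times 2m/β. Taking logarithms turns it into
    -- Δ < B.
    L<u : L m < u
    L<u = *-cancelˡ-< 0<m (<-resp
      (*-cancelˡ-≈ 0<β (begin-equality
        β * ((two * fromℕ m ^ 2) / β)      ≈⟨ trans (*-comm _ _) (/-cancel 0<β) ⟩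
        two * (fromℕ m * (fromℕ m * 1#))
          ≈⟨ solve 2 (λ t m → t :* (m :* (m :* con (+ 1))) := m :* (t :* m)) refl two (fromℕ m) ⟩
        fromℕ m * (two * fromℕ m)          ≈⟨ *-congˡ (Lβ≈2m m) ⟨
        fromℕ m * (L m * β)
          ≈⟨ solve 3 (λ m l β → m :* (l :* β) := β :* (m :* l)) refl (fromℕ m) (L m) β ⟩
        β * (fromℕ m * L m)                ∎))
      (trans (sym um≈n) (*-comm _ _))
      2m²/β<n)

    log-u : IsLog u B
    log-u = log-log₂ (<-trans (1<L 1≤m) L<u)

    0<B-Δ : 0# < B - Δ m
    0<B-Δ = <⇒0< (log-mono-< (log-L 1≤m) log-u L<u)

    0<B+Δ : 0# < B + Δ m
    0<B+Δ = +-pos (<-trans 0<1 (<-trans (1<Δ 1≤m) (log-mono-< (log-L 1≤m) log-u L<u)))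
                  (≤.trans 0≤1 (proj₁ (1<Δ 1≤m)))

    -- The exponential law is obtained by comparing logarithms: both sides have logarithm B. The
    -- product form avoids the logarithm of a quotient.
    2^[B-Δ]*L≈u : 2^ (B - Δ m) * L m ≈ u
    2^[B-Δ]*L≈u = log-injective (log-* (log-2^ (proj₁ 0<B-Δ)) (log-L 1≤m)) log-u
      (solve 2 (λ b δ → b :- δ :+ δ := b) refl B (Δ m))

    2^[B+Δ]≈uL : 2^ (B + Δ m) ≈ u * L m
    2^[B+Δ]≈uL = log-injective (log-2^ (proj₁ 0<B+Δ)) (log-* log-u (log-L 1≤m)) refl

    -- Keeps 1/(m 2^t) within [0,1], as the estimates of (1 - d)^n require.
    1≤m2^ : ∀ {t} → 0# < t → 1# ≤ fromℕ m * 2^ t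
    1≤m2^ 0<t = ≤-resp (*-identityˡ 1#) refl
      (*-mono-≤ 0≤1 (1≤fromℕ 1≤m) 0≤1 (1≤x (log-2^ (proj₁ 0<t))))

    module Reciprocal {z} (1≤z : 1# ≤ z) where
      0<z : 0# < z
      0<z = <-≤-trans 0<1 1≤z

      1/z*z≈1 : 1# / z * z ≈ 1#
      1/z*z≈1 = /-cancel 0<z

      0≤1/z : 0# ≤ 1# / z
      0≤1/z = proj₁ (/-pos 0<1 0<z)

      1/z≤1 : 1# / z ≤ 1#
      1/z≤1 = *-cancelˡ-≤ 0<z (≤-resp (sym (trans (*-comm _ _) 1/z*z≈1)) (sym (*-identityʳ z)) 1≤z)

    cdf : ℝ → ℝ
    cdf t = (1# - 1# / (fromℕ m * 2^ t)) ^ n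

    -- Here n d = 2m/β, and (1 - d)^n is at most the reciprocal of n d. Multiplying by 2m instead of
    -- dividing by it spares a quotient.
    lower-tail : cdf (B - Δ m) * (two * fromℕ m) ≤ β
    lower-tail = begin
      p * (two * fromℕ m)      ≈⟨ *-congˡ (Lβ≈2m m) ⟨
      p * (L m * β)            ≈⟨ *-congˡ (*-congʳ nd≈L) ⟨
      p * (fromℕ n * d * β)
        ≈⟨ solve 3 (λ p l β → p :* (l :* β) := β :* (p :* l)) refl p (fromℕ n * d) β ⟩
      β * (p * (fromℕ n * d))  ≤⟨ *-monoˡ-≤ (proj₁ 0<β) ([1-d]^n*nd≤1 n 0≤1/z 1/z≤1) ⟩
      β * 1#                   ≈⟨ *-identityʳ β ⟩
      β                        ∎
      where
      open Reciprocal (1≤m2^ 0<B-Δ)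
      X = 2^ (B - Δ m)
      d = 1# / (fromℕ m * X)
      p = cdf (B - Δ m)

      nd≈L : fromℕ n * d ≈ L m
      nd≈L = begin-equality
        fromℕ n * d                  ≈⟨ *-congʳ um≈n ⟨
        u * fromℕ m * d              ≈⟨ *-congʳ (*-congʳ 2^[B-Δ]*L≈u) ⟨
        X * L m * fromℕ m * d
          ≈⟨ solve 4 (λ x l m d → x :* l :* m :* d := d :* (m :* x) :* l) refl X (L m) (fromℕ m) d ⟩
        d * (fromℕ m * X) * L m      ≈⟨ *-congʳ 1/z*z≈1 ⟩
        1# * L m                     ≈⟨ *-identityˡ (L m) ⟩
        L m                          ∎

    -- Here n e is the reciprocal of 2m/β, and it bounds 1 - (1 - e)^n directly.
    upper-tail : (1# - cdf (B + Δ m)) * (two * fromℕ m) ≤ β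
    upper-tail = begin
      (1# - cdf (B + Δ m)) * (two * fromℕ m)  ≈⟨ *-comm _ _ ⟩
      two * fromℕ m * (1# - cdf (B + Δ m))
        ≤⟨ *-monoˡ-≤ (*-nonNeg (0≤fromℕ 2) (0≤fromℕ m)) (1-[1-d]^n≤nd n 1/z≤1) ⟩
      two * fromℕ m * (fromℕ n * e)           ≈⟨ *-cong (Lβ≈2m m) (*-congʳ um≈n) ⟨
      L m * β * (u * fromℕ m * e)
        ≈⟨ solve 5 (λ l β u m e → l :* β :* (u :* m :* e) :=
              β :* (e :* (m :* (u :* l)))) refl (L m) β u (fromℕ m) e ⟩
      β * (e * (fromℕ m * (u * L m)))         ≈⟨ *-congˡ (*-congˡ (*-congˡ 2^[B+Δ]≈uL)) ⟨
      β * (e * (fromℕ m * 2^ (B + Δ m)))      ≈⟨ *-congˡ 1/z*z≈1 ⟩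
      β * 1#                                  ≈⟨ *-identityʳ β ⟩
      β                                       ∎
      where
      open Reciprocal (1≤m2^ 0<B+Δ)
      e = 1# / (fromℕ m * 2^ (B + Δ m))

    tails : fromℕ m * (cdf (B - Δ m) + (1# - cdf (B + Δ m))) ≤ β
    tails = *-cancelˡ-≤ (0<fromℕ 1) (begin
      two * (fromℕ m * (p + q))
        ≈⟨ solve 4 (λ t m p q → t :* (m :* (p :+ q)) :=
              p :* (t :* m) :+ q :* (t :* m)) refl two (fromℕ m) p q ⟩
      p * (two * fromℕ m) + q * (two * fromℕ m)      ≤⟨ +-mono-≤ lower-tail upper-tail ⟩
      β + β
        ≈⟨ solve 1 (λ x → x :+ x := (con (+ 1) :+ con (+ 1)) :* x) refl β ⟩
      (1# + 1#) * β                                  ≈⟨ *-congʳ two≈1+1 ⟨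
      two * β                                        ∎)
      where
      p = cdf (B - Δ m)
      q = 1# - cdf (B + Δ m)

    module _ (S : HyperLogLog m n) where
      open HyperLogLog S using (space; Ω; Event; ℙ; ℙ-≐; M; M-measurable; ℙ[M≤t]; ℙ[M<t]; Event-∁; Event-≐)
      open Probability em R space

      InInterval : Fin m → Pred Ω 0ℓ
      InInterval j ω = OpenInterval (B - Δ m) (B + Δ m) (M j ω)

      Event-M< : ∀ j → Event (λ ω → M j ω < B + Δ m)
      Event-M< j = Event-< {M j} (M-measurable j) (B + Δ m)

      Event-InInterval : ∀ j → Event (InInterval j)
      Event-InInterval j = Event-∩
        (Event-≐ (≰⇒> , <⇒≱) (Event-∁ (M-measurable j (B - Δ m)))) (Event-M< j)

      ℙ-outside : ∀ j → ℙ (∁ (InInterval j)) ≤ cdf (B - Δ m) + (1# - cdf (B + Δ m))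
      ℙ-outside j = begin
        ℙ (∁ (InInterval j))          ≈⟨ ℙ-≐ (Event-∁ (Event-InInterval j)) (to , from) ⟩
        ℙ (Low ∪ ∁ NotHigh)           ≤⟨ ℙ-∪-≤ (M-measurable j (B - Δ m)) (Event-∁ (Event-M< j)) ⟩
        -- The interval is open, so a register equal to an endpoint counts as outside: the lower end
        -- uses the law of M ≤ t, the upper end that of M < t.
        ℙ Low + ℙ (∁ NotHigh)         ≈⟨ +-cong (ℙ[M≤t] j (B - Δ m) 0<B-Δ)
                          (trans (ℙ-∁ (Event-M< j)) (+-congˡ (-‿cong (ℙ[M<t] j (B + Δ m) 0<B+Δ)))) ⟩
        cdf (B - Δ m) + (1# - cdf (B + Δ m))  ∎
        where
        Low NotHigh : Pred Ω 0ℓ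
        Low ω = M j ω ≤ B - Δ m
        NotHigh ω = M j ω < B + Δ m

        to : ∀ {ω} → ¬ InInterval j ω → Low ω ⊎ ¬ NotHigh ω
        to {ω} outside = [ inj₁ , (λ lo → inj₂ λ hi → outside (lo , hi)) ]′ (M j ω ≤? B - Δ m)

        from : ∀ {ω} → Low ω ⊎ ¬ NotHigh ω → ¬ InInterval j ω
        from (inj₁ M≤) (lo , _) = <⇒≱ lo M≤
        from (inj₂ M≮) (_ , hi) = M≮ hi

      registers-in-interval : 1# - β ≤ ℙ (λ ω → ∀ j → InInterval j ω)
      registers-in-interval = ≤.trans (+-monoʳ-≤ 1# (neg-anti-≤ tails))
        (ℙ-∀-≥ _ Event-InInterval ℙ-outside)

theorem3p4 :
    (em : ExcludedMiddle 0ℓ) (R : RealField) →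
    let open Real em R in
    (β : ℝ) → 0# < β → β < 1# →
    let Δ    = λ (m : ℕ) → log₂ ((fromℕ 2 * fromℕ m) / β)
        bits = λ (m : ℕ) → ⌈ log₂ (log₂ ((fromℕ 2 * fromℕ m) / β)) ⌉ ℤ.+ + 1
    in
    ((m n : ℕ) .{{_ : NonZero m}} →
      (fromℕ 2 * fromℕ m ^ 2) / β < fromℕ n →
      (S : HyperLogLog m n) →
      let open HyperLogLog S
          B       = log₂ (fromℕ n / fromℕ m)
          I       = OpenInterval (B - Δ m) (B + Δ m)
          allInI  = λ ω → ∀ j → I (M j ω)
      in
      Event allInI × (1# - β ≤ ℙ allInI) ×
      (∃ λ d → (+ d ℤ.≤ bits m) × RepresentableAsOffsets B I d))
    × ((λ m → fromℤ (bits m)) =O (λ m → log₂ (log₂ (fromℕ m))))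
theorem3p4 em R β 0<β β<1 =
  (λ m n 2m²/β<n S →
    let 1≤m = ℕ.>-nonZero⁻¹ m in
    Probability.Event-∀ em R (Real.HyperLogLog.space S) (Event-InInterval {m} {n} 1≤m 2m²/β<n S) ,
    registers-in-interval {m} {n} 1≤m 2m²/β<n S ,
    offsets {m} 1≤m (proj₁ (0<B-Δ {m} {n} 1≤m 2m²/β<n)))
  , bits-bound
  where open RegisterBounds em R β 0<β β<1
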